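{- Identify each unital lattice-ordered group with its $\{+,\vee,\wedge,0,1,-1\}$-reduct (where $-1$ is the additive inverse of $1$), which is a unital commutative lattice-ordered monoid, and each MV-algebra with its $\{\oplus,\odot,\vee,\wedge,0,1\}$-reduct, which is an MV-monoidal algebra. Then the equivalence $\Gamma\colon\mathsf{ULM}\to\mathsf{MVM}$ restricts to an equivalence between the category $\mathsf{ULG}$ of unital lattice-ordered groups and the category $\mathsf{MV}$ of MV-algebras.
   Context: A unital commutative lattice-ordered monoid is an algebra $\langle M;+,\vee,\wedge,0,1,-1\rangle$ with $\langle M;\vee,\wedge\rangle$ a distributive lattice, $\langle M;+,0\rangle$ a commutative monoid, $+$ distributing over $\vee,\wedge$, $-1+1=0$, $0\le1$, and for each $x$ some $n\in\mathbb{N}$ with $(-1)+\dots+(-1)\le x\le1+\dots+1$ ($n$ summands); $\mathsf{ULM}$ is their category. An MV-monoidal algebra is an algebra $\langle A;\oplus,\odot,\vee,\wedge,0,1\rangle$ satisfying: $\langle A;\vee,\wedge\rangle$ distributive lattice; $\langle A;\oplus,0\rangle$, $\langle A;\odot,1\rangle$ commutative monoids; $\oplus,\odot$ distribute over $\vee,\wedge$; $(x\oplus y)\odot((x\odot y)\oplus z)=(x\odot(y\oplus z))\oplus(y\odot z)$; $(x\odot y)\oplus((x\oplus y)\odot z)=(x\oplus(y\odot z))\odot(y\oplus z)$; $(x\odot y)\oplus z=((x\oplus y)\odot((x\odot y)\oplus z))\vee z$; $(x\oplus y)\odot z=((x\odot y)\oplus((x\oplus y)\odot z))\wedge z$; $\mathsf{MVM}$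 is their category. $\Gamma(M)=\{x\in M\mid0\le x\le1\}$ with $\vee,\wedge,0,1$ restricted, $x\oplus y=(x+y)\wedge1$, $x\odot y=(x+y+(-1))\vee0$, and $\Gamma$ acts on morphisms by restriction; it is an equivalence of categories. A unital lattice-ordered group is an algebra $\langle G;+,\vee,\wedge,0,-,1\rangle$ with $\langle G;\vee,\wedge\rangle$ a distributive lattice, $\langle G;+,0,-\rangle$ an abelian group, $+$ distributing over $\vee,\wedge$, $0\le1$, and each $x\le n1$ for some $n$. An MV-algebra is $\langle A;\oplus,\neg,0\rangle$ with $\langle A;\oplus,0\rangle$ a commutative monoid, $\neg0\oplus x=\neg0$, $\neg\neg x=x$, $\neg(\neg x\oplus y)\oplus y=\neg(\neg y\oplus x)\oplus x$; in it $1=\neg0$, $x\odot y=\neg(\neg x\oplus\neg y)$, $x\vee y=(x\odot\neg y)\oplus y$, $x\wedge y=x\odot(\neg x\oplus y)$. -}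

module Defs where

open import Level using (Level; _⊔_; Setω) renaming (suc to lsuc)
open import Data.Nat using (ℕ; zero; suc)
open import Data.Product using (Σ; _×_; _,_; proj₁; proj₂)
open import Relation.Binary.Core using (Rel)
open import Relation.Binary.Bundles using (Setoid)
open import Algebra.Core using (Op₁; Op₂)
open import Algebra.Structures using (IsCommutativeMonoid; IsAbelianGroup)
open import Algebra.Lattice.Structures using (IsDistributiveLattice)
import Algebra.Definitions as AD
import Relation.Binary.Reasoning.Setoid as SetoidReasoning

times : ∀ {a} {A : Set a} → Op₂ A → A → ℕ → A → A
times _+_ e zero    x = e
times _+_ e (suc n) x = x + times _+_ e n x

LeqFromMeet : ∀ {a ℓ} {A : Set a} → Rel A ℓ → Op₂ A → Rel A ℓ
LeqFromMeet _≈_ _∧_ x y = (x ∧ y) ≈ x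

record ULM (c ℓ : Level) : Set (lsuc (c ⊔ ℓ)) where
  infix 4 _≈_ _≤_
  field
    Carrier : Set c
    _≈_     : Rel Carrier ℓ
    _+_     : Op₂ Carrier
    _∨_     : Op₂ Carrier
    _∧_     : Op₂ Carrier
    0#      : Carrier
    1#      : Carrier
    -1#     : Carrier
    isDistributiveLattice : IsDistributiveLattice _≈_ _∨_ _∧_
    +-isCommutativeMonoid : IsCommutativeMonoid _≈_ _+_ 0#
    +-distrib-∨ : AD._DistributesOver_ _≈_ _+_ _∨_
    +-distrib-∧ : AD._DistributesOver_ _≈_ _+_ _∧_
    -1+1≈0  : (-1# + 1#) ≈ 0#

  _≤_ : Rel Carrier ℓ
  _≤_ = LeqFromMeet _≈_ _∧_

  field
    0≤1       : 0# ≤ 1#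
    unitBound : ∀ x → Σ ℕ λ n → (times _+_ 0# n -1#) ≤ x × x ≤ (times _+_ 0# n 1#)

  open IsDistributiveLattice isDistributiveLattice public
    using (isEquivalence; refl; sym; trans; ∨-comm; ∨-assoc; ∨-cong; ∧-comm; ∧-assoc; ∧-cong;
           ∨-absorbs-∧; ∧-absorbs-∨; ∧-distribʳ-∨; ∧-congˡ; ∧-congʳ)
  open IsCommutativeMonoid +-isCommutativeMonoid public
    using ()
    renaming (∙-cong to +-cong; assoc to +-assoc; comm to +-comm;
              identityˡ to +-identityˡ; identityʳ to +-identityʳ)

  setoid : Setoid c ℓ
  setoid = record { isEquivalence = isEquivalence }

record ULM-homomorphism {c₁ ℓ₁ c₂ ℓ₂} (M : ULM c₁ ℓ₁) (N : ULM c₂ ℓ₂)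
       : Set (c₁ ⊔ ℓ₁ ⊔ c₂ ⊔ ℓ₂) where
  private
    module M = ULM M
    module N = ULM N
  field
    ⟦_⟧     : M.Carrier → N.Carrier
    cong    : ∀ {x y} → x M.≈ y → ⟦ x ⟧ N.≈ ⟦ y ⟧
    hom-+   : ∀ x y → ⟦ x M.+ y ⟧ N.≈ (⟦ x ⟧ N.+ ⟦ y ⟧)
    hom-∨   : ∀ x y → ⟦ x M.∨ y ⟧ N.≈ (⟦ x ⟧ N.∨ ⟦ y ⟧)
    hom-∧   : ∀ x y → ⟦ x M.∧ y ⟧ N.≈ (⟦ x ⟧ N.∧ ⟦ y ⟧)
    hom-0   : ⟦ M.0# ⟧ N.≈ N.0#
    hom-1   : ⟦ M.1# ⟧ N.≈ N.1#
    hom--1  : ⟦ M.-1# ⟧ N.≈ N.-1#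

-- Unital lattice-ordered groups, and the full subcategory ULG of ULM:
-- a ULM is (the {+,∨,∧,0,1,-1}-reduct of) a unital ℓ-group iff there is
-- a negation  -_  making  ⟨M;+,∨,∧,0,-,1⟩  a unital ℓ-group with  -1 = -(1).

record IsUnitalLGroup {c ℓ} {A : Set c} (_≈_ : Rel A ℓ)
       (_+_ _∨_ _∧_ : Op₂ A) (0# : A) (-_ : Op₁ A) (1# : A) : Set (c ⊔ ℓ) where
  field
    isDistributiveLattice : IsDistributiveLattice _≈_ _∨_ _∧_
    +-isAbelianGroup      : IsAbelianGroup _≈_ _+_ 0# -_
    +-distrib-∨ : AD._DistributesOver_ _≈_ _+_ _∨_
    +-distrib-∧ : AD._DistributesOver_ _≈_ _+_ _∧_
    0≤1         : LeqFromMeet _≈_ _∧_ 0# 1#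
    unitBound   : ∀ x → Σ ℕ λ n → LeqFromMeet _≈_ _∧_ x (times _+_ 0# n 1#)

IsULGReduct : ∀ {c ℓ} → ULM c ℓ → Set (c ⊔ ℓ)
IsULGReduct M = Σ (Op₁ Carrier) λ -_ →
    IsUnitalLGroup _≈_ _+_ _∨_ _∧_ 0# -_ 1# × ((- 1#) ≈ -1#)
  where open ULM M

record RawMVM (c ℓ : Level) : Set (lsuc (c ⊔ ℓ)) where
  infix 4 _≈_
  field
    Carrier : Set c
    _≈_     : Rel Carrier ℓ
    _⊕_     : Op₂ Carrier
    _⊙_     : Op₂ Carrier
    _∨_     : Op₂ Carrier
    _∧_     : Op₂ Carrier
    0#      : Carrier
    1#      : Carrier

record MVM-homomorphism {c₁ ℓ₁ c₂ ℓ₂} (A : RawMVM c₁ ℓ₁) (B : RawMVM c₂ ℓ₂)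
       : Set (c₁ ⊔ ℓ₁ ⊔ c₂ ⊔ ℓ₂) where
  private
    module A = RawMVM A
    module B = RawMVM B
  field
    ⟦_⟧   : A.Carrier → B.Carrier
    cong  : ∀ {x y} → x A.≈ y → ⟦ x ⟧ B.≈ ⟦ y ⟧
    hom-⊕ : ∀ x y → ⟦ x A.⊕ y ⟧ B.≈ (⟦ x ⟧ B.⊕ ⟦ y ⟧)
    hom-⊙ : ∀ x y → ⟦ x A.⊙ y ⟧ B.≈ (⟦ x ⟧ B.⊙ ⟦ y ⟧)
    hom-∨ : ∀ x y → ⟦ x A.∨ y ⟧ B.≈ (⟦ x ⟧ B.∨ ⟦ y ⟧)
    hom-∧ : ∀ x y → ⟦ x A.∧ y ⟧ B.≈ (⟦ x ⟧ B.∧ ⟦ y ⟧)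
    hom-0 : ⟦ A.0# ⟧ B.≈ B.0#
    hom-1 : ⟦ A.1# ⟧ B.≈ B.1#

record MVM-isomorphism {c₁ ℓ₁ c₂ ℓ₂} (A : RawMVM c₁ ℓ₁) (B : RawMVM c₂ ℓ₂)
       : Set (c₁ ⊔ ℓ₁ ⊔ c₂ ⊔ ℓ₂) where
  private
    module A = RawMVM A
    module B = RawMVM B
  field
    to   : MVM-homomorphism A B
    from : MVM-homomorphism B A
  open MVM-homomorphism
  field
    from∘to : ∀ x → ⟦ from ⟧ (⟦ to ⟧ x) A.≈ x
    to∘from : ∀ y → ⟦ to ⟧ (⟦ from ⟧ y) B.≈ y

record IsMVAlgebra {c ℓ} {A : Set c} (_≈_ : Rel A ℓ)
       (_⊕_ : Op₂ A) (¬_ : Op₁ A) (0# : A) : Set (c ⊔ ℓ) where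
  field
    ⊕-isCommutativeMonoid : IsCommutativeMonoid _≈_ _⊕_ 0#
    ¬-cong   : ∀ {x y} → x ≈ y → (¬ x) ≈ (¬ y)
    ¬0-absorb : ∀ x → ((¬ 0#) ⊕ x) ≈ (¬ 0#)
    ¬¬-involutive : ∀ x → (¬ (¬ x)) ≈ x
    łukasiewicz : ∀ x y → ((¬ ((¬ x) ⊕ y)) ⊕ y) ≈ ((¬ ((¬ y) ⊕ x)) ⊕ x)

record MVAlgebra (c ℓ : Level) : Set (lsuc (c ⊔ ℓ)) where
  field
    Carrier : Set c
    _≈_     : Rel Carrier ℓ
    _⊕_     : Op₂ Carrier
    ¬_      : Op₁ Carrier
    0#      : Carrier
    isMVAlgebra : IsMVAlgebra _≈_ _⊕_ ¬_ 0#

module MVDerived {c} {A : Set c} (_⊕_ : Op₂ A) (¬_ : Op₁ A) (0# : A) where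
  1# : A
  1# = ¬ 0#
  _⊙_ : Op₂ A
  x ⊙ y = ¬ ((¬ x) ⊕ (¬ y))
  _∨_ : Op₂ A
  x ∨ y = (x ⊙ (¬ y)) ⊕ y
  _∧_ : Op₂ A
  x ∧ y = x ⊙ ((¬ x) ⊕ y)

mvReduct : ∀ {c ℓ} → MVAlgebra c ℓ → RawMVM c ℓ
mvReduct B = record
  { Carrier = Carrier ; _≈_ = _≈_ ; _⊕_ = _⊕_ ; _⊙_ = D._⊙_
  ; _∨_ = D._∨_ ; _∧_ = D._∧_ ; 0# = 0# ; 1# = D.1# }
  where
    open MVAlgebra B
    module D = MVDerived _⊕_ ¬_ 0#

-- the full subcategory MV of MVM: structures that are the reduct of an
-- MV-algebra (with the same ⊕ and 0, and ⊙, ∨, ∧, 1 the derived ones)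
IsMVReduct : ∀ {c ℓ} → RawMVM c ℓ → Set (c ⊔ ℓ)
IsMVReduct A = Σ (Op₁ Carrier) λ ¬_ →
    let module D = MVDerived _⊕_ ¬_ 0# in
    IsMVAlgebra _≈_ _⊕_ ¬_ 0#
    × (∀ x y → (x ⊙ y) ≈ (x D.⊙ y))
    × (∀ x y → (x ∨ y) ≈ (x D.∨ y))
    × (∀ x y → (x ∧ y) ≈ (x D.∧ y))
    × (1# ≈ D.1#)
  where open RawMVM A

module ULMLemmas {c ℓ} (M : ULM c ℓ) where
  open ULM M
  open SetoidReasoning setoid

  ∧-idem : ∀ x → (x ∧ x) ≈ x
  ∧-idem x = begin
    x ∧ x             ≈⟨ ∧-congˡ (sym (∨-absorbs-∧ x x)) ⟩
    x ∧ (x ∨ (x ∧ x)) ≈⟨ ∧-absorbs-∨ x (x ∧ x) ⟩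
    x                 ∎

  ≤-refl : ∀ {x} → x ≤ x
  ≤-refl {x} = ∧-idem x

  ≤-trans : ∀ {x y z} → x ≤ y → y ≤ z → x ≤ z
  ≤-trans {x} {y} {z} xy yz = begin
    x ∧ z        ≈⟨ ∧-congʳ (sym xy) ⟩
    (x ∧ y) ∧ z  ≈⟨ ∧-assoc x y z ⟩
    x ∧ (y ∧ z)  ≈⟨ ∧-congˡ yz ⟩
    x ∧ y        ≈⟨ xy ⟩
    x            ∎

  ≤-resp : ∀ {x x' y y'} → x ≈ x' → y ≈ y' → x ≤ y → x' ≤ y'
  ≤-resp {x} {x'} {y} {y'} xx yy xy = begin
    x' ∧ y' ≈⟨ ∧-cong (sym xx) (sym yy) ⟩
    x ∧ y   ≈⟨ xy ⟩
    x       ≈⟨ xx ⟩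
    x'      ∎

  ∧-glb : ∀ {x y z} → z ≤ x → z ≤ y → z ≤ (x ∧ y)
  ∧-glb {x} {y} {z} zx zy = begin
    z ∧ (x ∧ y) ≈⟨ sym (∧-assoc z x y) ⟩
    (z ∧ x) ∧ y ≈⟨ ∧-congʳ zx ⟩
    z ∧ y       ≈⟨ zy ⟩
    z           ∎

  x∧y≤x : ∀ x y → (x ∧ y) ≤ x
  x∧y≤x x y = begin
    (x ∧ y) ∧ x  ≈⟨ ∧-assoc x y x ⟩
    x ∧ (y ∧ x)  ≈⟨ ∧-congˡ (∧-comm y x) ⟩
    x ∧ (x ∧ y)  ≈⟨ sym (∧-assoc x x y) ⟩
    (x ∧ x) ∧ y  ≈⟨ ∧-congʳ (∧-idem x) ⟩
    x ∧ y        ∎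

  x∧y≤y : ∀ x y → (x ∧ y) ≤ y
  x∧y≤y x y = begin
    (x ∧ y) ∧ y  ≈⟨ ∧-assoc x y y ⟩
    x ∧ (y ∧ y)  ≈⟨ ∧-congˡ (∧-idem y) ⟩
    x ∧ y        ∎

  x≤x∨y : ∀ x y → x ≤ (x ∨ y)
  x≤x∨y x y = ∧-absorbs-∨ x y

  y≤x∨y : ∀ x y → y ≤ (x ∨ y)
  y≤x∨y x y = ≤-resp refl (∨-comm y x) (x≤x∨y y x)

  ∨-lub : ∀ {x y z} → x ≤ z → y ≤ z → (x ∨ y) ≤ z
  ∨-lub {x} {y} {z} xz yz = begin
    (x ∨ y) ∧ z        ≈⟨ ∧-distribʳ-∨ z x y ⟩
    (x ∧ z) ∨ (y ∧ z)  ≈⟨ ∨-cong xz yz ⟩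
    x ∨ y              ∎

  +-monoˡ-≤ : ∀ {x y} z → x ≤ y → (x + z) ≤ (y + z)
  +-monoˡ-≤ {x} {y} z xy = begin
    (x + z) ∧ (y + z) ≈⟨ sym (proj₂ +-distrib-∧ z x y) ⟩
    (x ∧ y) + z       ≈⟨ +-cong xy refl ⟩
    x + z             ∎

  +-monoʳ-≤ : ∀ {x y} z → x ≤ y → (z + x) ≤ (z + y)
  +-monoʳ-≤ {x} {y} z xy = ≤-resp (+-comm x z) (+-comm y z) (+-monoˡ-≤ z xy)

  +-nonneg : ∀ {x y} → 0# ≤ x → 0# ≤ y → 0# ≤ (x + y)
  +-nonneg {x} {y} 0x 0y =
    ≤-trans 0y (≤-resp (+-identityˡ y) refl (+-monoˡ-≤ y 0x))

  ⊙-bound : ∀ {x y} → x ≤ 1# → y ≤ 1# → ((x + y) + -1#) ≤ 1#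
  ⊙-bound {x} {y} x1 y1 =
    ≤-trans (+-monoˡ-≤ -1# (≤-trans (+-monoˡ-≤ y x1) (+-monoʳ-≤ 1# y1)))
            (≤-resp refl eq ≤-refl)
    where
      eq : ((1# + 1#) + -1#) ≈ 1#
      eq = begin
        (1# + 1#) + -1#  ≈⟨ +-assoc 1# 1# -1# ⟩
        1# + (1# + -1#)  ≈⟨ +-cong refl (+-comm 1# -1#) ⟩
        1# + (-1# + 1#)  ≈⟨ +-cong refl -1+1≈0 ⟩
        1# + 0#          ≈⟨ +-identityʳ 1# ⟩
        1#               ∎

Γ : ∀ {c ℓ} → ULM c ℓ → RawMVM (c ⊔ ℓ) ℓ
Γ M = record
  { Carrier = I
  ; _≈_ = λ a b → proj₁ a ≈ proj₁ b
  ; _⊕_ = λ a b → ((proj₁ a + proj₁ b) ∧ 1#)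
                 , ∧-glb (+-nonneg (proj₁ (proj₂ a)) (proj₁ (proj₂ b))) 0≤1
                 , x∧y≤y _ _
  ; _⊙_ = λ a b → (((proj₁ a + proj₁ b) + -1#) ∨ 0#)
                 , y≤x∨y _ _
                 , ∨-lub (⊙-bound (proj₂ (proj₂ a)) (proj₂ (proj₂ b))) 0≤1
  ; _∨_ = λ a b → (proj₁ a ∨ proj₁ b)
                 , ≤-trans (proj₁ (proj₂ a)) (x≤x∨y _ _)
                 , ∨-lub (proj₂ (proj₂ a)) (proj₂ (proj₂ b))
  ; _∧_ = λ a b → (proj₁ a ∧ proj₁ b)
                 , ∧-glb (proj₁ (proj₂ a)) (proj₁ (proj₂ b))
                 , ≤-trans (x∧y≤x _ _) (proj₂ (proj₂ a))
  ; 0# = 0# , ≤-refl , 0≤1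
  ; 1# = 1# , 0≤1 , ≤-refl
  }
  where
    open ULM M
    open ULMLemmas M
    I = Σ Carrier λ x → (0# ≤ x) × (x ≤ 1#)

Γ-hom : ∀ {c₁ ℓ₁ c₂ ℓ₂} {M : ULM c₁ ℓ₁} {N : ULM c₂ ℓ₂} →
        ULM-homomorphism M N → MVM-homomorphism (Γ M) (Γ N)
Γ-hom {M = M} {N = N} f = record
  { ⟦_⟧ = λ a → ⟦ proj₁ a ⟧ , pos (proj₁ (proj₂ a)) , le1 (proj₂ (proj₂ a))
  ; cong = cong
  ; hom-⊕ = λ a b → N.trans (hom-∧ _ _) (N.∧-cong (hom-+ _ _) hom-1)
  ; hom-⊙ = λ a b → N.trans (hom-∨ _ _)
                     (N.∨-cong (N.trans (hom-+ _ _) (N.+-cong (hom-+ _ _) hom--1)) hom-0)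
  ; hom-∨ = λ a b → hom-∨ _ _
  ; hom-∧ = λ a b → hom-∧ _ _
  ; hom-0 = hom-0
  ; hom-1 = hom-1
  }
  where
    module M = ULM M
    module N = ULM N
    module LN = ULMLemmas N
    open ULM-homomorphism f
    mono : ∀ {x y} → x M.≤ y → ⟦ x ⟧ N.≤ ⟦ y ⟧
    mono xy = N.trans (N.sym (hom-∧ _ _)) (cong xy)
    pos : ∀ {x} → M.0# M.≤ x → N.0# N.≤ ⟦ x ⟧
    pos p = LN.≤-resp hom-0 N.refl (mono p)
    le1 : ∀ {x} → x M.≤ M.1# → ⟦ x ⟧ N.≤ N.1#
    le1 p = LN.≤-resp N.refl hom-1 (mono p)

-- The statement "Γ restricts to an equivalence ULG → MV", where ULG and
-- MV are regarded (via the reducts) as full subcategories of ULM and MVM: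
--  * Γ maps objects of ULG to objects of MV;
--  * the restricted functor is faithful and full;
--  * it is essentially surjective: every MV-algebra is, as an MV-monoidal
--    algebra, isomorphic to Γ(G) for some unital ℓ-group G.

record ΓRestrictsToEquivalence : Setω where
  field
    Γ-ULG→MV : ∀ {c ℓ} (G : ULM c ℓ) → IsULGReduct G → IsMVReduct (Γ G)
    Γ-faithful : ∀ {c₁ ℓ₁ c₂ ℓ₂} (G : ULM c₁ ℓ₁) (H : ULM c₂ ℓ₂) →
      IsULGReduct G → IsULGReduct H →
      (f g : ULM-homomorphism G H) →
      (∀ a → RawMVM._≈_ (Γ H) (MVM-homomorphism.⟦ Γ-hom f ⟧ a)
                              (MVM-homomorphism.⟦ Γ-hom g ⟧ a)) →
      ∀ x → ULM._≈_ H (ULM-homomorphism.⟦ f ⟧ x) (ULM-homomorphism.⟦ g ⟧ x)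
    Γ-full : ∀ {c₁ ℓ₁ c₂ ℓ₂} (G : ULM c₁ ℓ₁) (H : ULM c₂ ℓ₂) →
      IsULGReduct G → IsULGReduct H →
      (h : MVM-homomorphism (Γ G) (Γ H)) →
      Σ (ULM-homomorphism G H) λ f →
        ∀ a → RawMVM._≈_ (Γ H) (MVM-homomorphism.⟦ Γ-hom f ⟧ a)
                               (MVM-homomorphism.⟦ h ⟧ a)
    Γ-essentiallySurjective : ∀ {c ℓ} (A : MVAlgebra c ℓ) →
      Σ (ULM (c ⊔ ℓ) (c ⊔ ℓ)) λ G →
        IsULGReduct G × MVM-isomorphism (Γ G) (mvReduct A)

{-# OPTIONS --safe #-}
module Submission where

-- The positive cone of an ℓ-group carries the truncated difference
-- x ∸ y = (x − y) ∨ 0, which satisfies (x + u) ∸ v = (x ∸ v) + (u ∸ (v ∸ x)).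
-- This identity extends a difference on the letters of an MV-algebra,
-- x ∸ y = x ⊙ ¬ y, to words of letters, read as formal sums.  Put u ≤ v when all
-- letters of u ∸ v vanish.  The cube law (x ∸ y) ∸ (z ∸ y) = (x ∸ z) ∸ (y ∸ z)
-- passes from letters to words and makes words a cancellative, residuated,
-- commutative monoid; its group of differences is a unital ℓ-group in which every
-- word below the unit is equivalent to the letter 1 ∸ (1 ∸ w).
-- Conversely, every element of a unital ℓ-group is a difference of two sums of
-- elements of the unit interval, and taking sums commutes with ∸.  A homomorphism h
-- of unit intervals preserves ∸, so Σ u ≤ Σ v (that is, u ∸ v vanishes) implies
-- Σ h(u) ≤ Σ h(v), and h extends uniquely along differences of sums.

open import Level using (Level; _⊔_) renaming (suc to lsuc)
open import Algebra.Core using (Op₁; Op₂)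
open import Algebra.Bundles using (AbelianGroup; CommutativeMonoid)
open import Algebra.Structures using (IsCommutativeMonoid; IsAbelianGroup)
open import Algebra.Lattice.Structures using (IsDistributiveLattice; module IsLattice)
import Algebra.Definitions as AD
import Algebra.Properties.AbelianGroup as AbelianGroupProperties
import Algebra.Properties.CommutativeSemigroup as CommutativeSemigroupProperties
import Algebra.Solver.CommutativeMonoid as CommutativeMonoidSolver
open import Data.List using (List; []; _∷_; [_]; _++_)
open import Data.List.Properties using (++-assoc; ++-identityʳ)
open import Data.List.Relation.Unary.All using (All; []; _∷_)
import Data.List.Relation.Unary.All.Properties as All
open import Data.List.Relation.Binary.Pointwise using (Pointwise; []; _∷_; ++⁺)
import Data.List.Relation.Binary.Pointwise as Pointwise
open import Data.Nat using (ℕ; zero; suc)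
open import Data.Product using (Σ; _×_; _,_; proj₁; proj₂)
open import Relation.Binary.Core using (Rel)
open import Relation.Binary.Structures using (IsEquivalence; IsPartialOrder)
open import Relation.Binary.Bundles using (Setoid; Poset)
open import Relation.Binary.Lattice.Definitions using (Supremum; Infimum)
open import Relation.Binary.Lattice.Bundles using (Lattice; DistributiveLattice)
import Relation.Binary.Lattice.Properties.Lattice as LatticeProperties
import Relation.Binary.Lattice.Properties.DistributiveLattice as DistributiveLatticeProperties
open import Relation.Binary.PropositionalEquality as ≡ using (_≡_)
import Relation.Binary.Reasoning.Setoid as SetoidReasoning
import Relation.Binary.Reasoning.PartialOrder as PosetReasoning
open import Defs

-- Words over a difference algebra

module Words {a} {A : Set a} (_∸_ : Op₂ A) where

  infixl 6 _⊘_ _⊖_ _⊝_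

  _⊘_ : A → List A → A
  x ⊘ []      = x
  x ⊘ (y ∷ v) = (x ∸ y) ⊘ v

  -- The first letter absorbs what it can of `x`, and the remainder `x ∸ y` is passed on to the
  -- later letters.
  _⊖_ : List A → A → List A
  []      ⊖ x = []
  (y ∷ v) ⊖ x = (y ∸ x) ∷ (v ⊖ (x ∸ y))

  -- Read a word as the sum of its letters: this is the identity
  -- (x + u) ∸ v = (x ∸ v) + (u ∸ (v ∸ x)) of positive cones of ℓ-groups.
  _⊝_ : List A → List A → List A
  []      ⊝ v = []
  (x ∷ u) ⊝ v = (x ⊘ v) ∷ (u ⊝ (v ⊖ x))

  ⊘-++ : ∀ x b c → x ⊘ (b ++ c) ≡ x ⊘ b ⊘ c
  ⊘-++ x []      c = ≡.refl
  ⊘-++ x (y ∷ b) c = ⊘-++ (x ∸ y) b c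

  ++-⊖ : ∀ b c x → (b ++ c) ⊖ x ≡ (b ⊖ x) ++ (c ⊖ (x ⊘ b))
  ++-⊖ []      c x = ≡.refl
  ++-⊖ (y ∷ b) c x = ≡.cong ((y ∸ x) ∷_) (++-⊖ b c (x ∸ y))

  ⊝-++ : ∀ a b c → a ⊝ (b ++ c) ≡ a ⊝ b ⊝ c
  ⊝-++ []      b c = ≡.refl
  ⊝-++ (x ∷ a) b c = ≡.cong₂ _∷_ (⊘-++ x b c)
    (≡.trans (≡.cong (a ⊝_) (++-⊖ b c x)) (⊝-++ a (b ⊖ x) (c ⊖ (x ⊘ b))))

  ⊝-[] : ∀ a → a ⊝ [] ≡ a
  ⊝-[] []      = ≡.refl
  ⊝-[] (x ∷ a) = ≡.cong (x ∷_) (⊝-[] a)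

  ⊝-[-] : ∀ a x → a ⊝ [ x ] ≡ a ⊖ x
  ⊝-[-] []      x = ≡.refl
  ⊝-[-] (y ∷ a) x = ≡.cong ((y ∸ x) ∷_) (⊝-[-] a (x ∸ y))

  ⊝-∷ : ∀ a x b → a ⊝ (x ∷ b) ≡ a ⊖ x ⊝ b
  ⊝-∷ a x b = ≡.trans (⊝-++ a [ x ] b) (≡.cong (_⊝ b) (⊝-[-] a x))

  -- The recursive clause of `_⊝_` with a word `b` in place of its first letter: `c` faces only what
  -- `b` leaves of `a`.
  ++-⊝ : ∀ b c a → (b ++ c) ⊝ a ≡ (b ⊝ a) ++ (c ⊝ (a ⊝ b))
  ++-⊝ []      c a = ≡.cong (c ⊝_) (≡.sym (⊝-[] a))
  ++-⊝ (x ∷ b) c a = ≡.cong ((x ⊘ a) ∷_)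
    (≡.trans (++-⊝ b c (a ⊖ x))
             (≡.cong (λ w → (b ⊝ (a ⊖ x)) ++ (c ⊝ w)) (≡.sym (⊝-∷ a x b))))

-- The laws apart from `cube` are those of commutative BCK-algebras; `cube` is the defining equation
-- of L-algebras, with `y ∸ x` read as the implication from `x` to `y`.
record IsDifferenceAlgebra {a ℓ} {A : Set a} (_≈_ : Rel A ℓ) (_∸_ : Op₂ A) (0# : A)
       : Set (a ⊔ ℓ) where
  field
    isEquivalence : IsEquivalence _≈_
    ∸-cong   : ∀ {x x′ y y′} → x ≈ x′ → y ≈ y′ → (x ∸ y) ≈ (x′ ∸ y′)
    x∸0≈x    : ∀ x → (x ∸ 0#) ≈ x
    0∸x≈0    : ∀ x → (0# ∸ x) ≈ 0#
    x∸x≈0    : ∀ x → (x ∸ x) ≈ 0#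
    exchange : ∀ x y z → ((x ∸ y) ∸ z) ≈ ((x ∸ z) ∸ y)
    -- Both sides are the meet of x and y.
    meet-comm : ∀ x y → (x ∸ (x ∸ y)) ≈ (y ∸ (y ∸ x))
    -- Both sides are x minus the join of y and z.
    cube     : ∀ x y z → ((x ∸ y) ∸ (z ∸ y)) ≈ ((x ∸ z) ∸ (y ∸ z))

-- Equality is mutual `≤`, so antisymmetry holds by definition. Residuation determines `_∸_` up to
-- this equality, and the last field makes the order the divisibility order of `+`.
record Cone (c ℓ : Level) : Set (lsuc (c ⊔ ℓ)) where
  infix 4 _≤_ _≈_
  infixl 6 _+_ _∸_
  field
    Carrier : Set c
    _≤_     : Rel Carrier ℓ
    _+_     : Op₂ Carrier
    0#      : Carrier
    _∸_     : Op₂ Carrier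

  _≈_ : Rel Carrier ℓ
  x ≈ y = x ≤ y × y ≤ x

  field
    ≤-refl     : ∀ x → x ≤ x
    ≤-trans    : ∀ {x y z} → x ≤ y → y ≤ z → x ≤ z
    +-isCommutativeMonoid : IsCommutativeMonoid _≈_ _+_ 0#
    +-monoʳ-≤  : ∀ z {x y} → x ≤ y → z + x ≤ z + y
    +-cancelˡ-≤ : ∀ z {x y} → z + x ≤ z + y → x ≤ y
    0≤x        : ∀ x → 0# ≤ x
    ∸≤⇒≤+      : ∀ x y z → x ∸ y ≤ z → x ≤ y + z
    ≤+⇒∸≤      : ∀ x y z → x ≤ y + z → x ∸ y ≤ z
    y+[x∸y]≤x  : ∀ x y → y ≤ x → y + (x ∸ y) ≤ x

-- The ordered monoid of words

module WordCone {a ℓ} {A : Set a} {_≈_ : Rel A ℓ} {_∸_ : Op₂ A} {0# : A}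
                (isDifferenceAlgebra : IsDifferenceAlgebra _≈_ _∸_ 0#) where
  open IsDifferenceAlgebra isDifferenceAlgebra
  open IsEquivalence isEquivalence
  open Words _∸_ public

  setoid : Setoid a ℓ
  setoid = record { isEquivalence = isEquivalence }

  infix 4 _≋_ _≤_ _~_

  _≋_ : Rel (List A) (a ⊔ ℓ)
  _≋_ = Pointwise _≈_

  ≋-setoid : Setoid a (a ⊔ ℓ)
  ≋-setoid = Pointwise.setoid setoid

  open Setoid ≋-setoid using ()
    renaming (refl to ≋-refl; sym to ≋-sym; trans to ≋-trans; reflexive to ≋-reflexive)

  ⊘-cong : ∀ {x y u v} → x ≈ y → u ≋ v → (x ⊘ u) ≈ (y ⊘ v)
  ⊘-cong p []      = p
  ⊘-cong p (q ∷ r) = ⊘-cong (∸-cong p q) r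

  ⊖-cong : ∀ {x y u v} → u ≋ v → x ≈ y → u ⊖ x ≋ v ⊖ y
  ⊖-cong []      p = []
  ⊖-cong (q ∷ r) p = ∸-cong q p ∷ ⊖-cong r (∸-cong p q)

  ⊝-cong : ∀ {u u′ v v′} → u ≋ u′ → v ≋ v′ → u ⊝ v ≋ u′ ⊝ v′
  ⊝-cong []      q = []
  ⊝-cong (p ∷ r) q = ⊘-cong p q ∷ ⊝-cong r (⊖-cong q p)

  -- `≋-sym` exchanges the last two words of a `Cube`, which lets the inductions below keep the word
  -- being split in the middle.
  Cube : List A → List A → List A → Set (a ⊔ ℓ)
  Cube a b c = a ⊝ b ⊝ (c ⊝ b) ≋ a ⊝ c ⊝ (b ⊝ c)

  open SetoidReasoning ≋-setoid

  -- The heads agree by the cube for `[ x ]`. In the tails, cubes with `[ x ]` in last place rewrite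
  -- the subtrahends, `(c ⊝ b) ⊖ (x ⊘ b)` becoming `(c ⊖ x) ⊝ (b ⊖ x)`, and what remains is a cube
  -- for the shorter word `a`.
  cube-splitˡ : ∀ x a b c → Cube [ x ] b c → Cube c b [ x ] → Cube b c [ x ] →
                Cube a (b ⊖ x) (c ⊖ x) → Cube (x ∷ a) b c
  cube-splitˡ x a b c xbc cbx bcx rest = begin
    (x ∷ a) ⊝ b ⊝ (c ⊝ b)
      ≡⟨⟩
    (x ⊘ b ⊘ (c ⊝ b)) ∷ (a ⊝ (b ⊖ x) ⊝ ((c ⊝ b) ⊖ (x ⊘ b)))
      ≈⟨ Pointwise.head xbc ∷ ⊝-cong ≋-refl (swap b c cbx) ⟩
    (x ⊘ c ⊘ (b ⊝ c)) ∷ (a ⊝ (b ⊖ x) ⊝ ((c ⊖ x) ⊝ (b ⊖ x)))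
      ≈⟨ refl ∷ rest ⟩
    (x ⊘ c ⊘ (b ⊝ c)) ∷ (a ⊝ (c ⊖ x) ⊝ ((b ⊖ x) ⊝ (c ⊖ x)))
      ≈⟨ refl ∷ ⊝-cong ≋-refl (swap c b bcx) ⟨
    (x ⊘ c ⊘ (b ⊝ c)) ∷ (a ⊝ (c ⊖ x) ⊝ ((b ⊝ c) ⊖ (x ⊘ c))) ∎
    where
    swap : ∀ b c → Cube c b [ x ] → (c ⊝ b) ⊖ (x ⊘ b) ≋ (c ⊖ x) ⊝ (b ⊖ x)
    swap b c cbx = begin
      (c ⊝ b) ⊖ (x ⊘ b)         ≡⟨ ⊝-[-] (c ⊝ b) (x ⊘ b) ⟨
      c ⊝ b ⊝ ([ x ] ⊝ b)       ≈⟨ cbx ⟩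
      c ⊝ [ x ] ⊝ (b ⊝ [ x ])   ≡⟨ ≡.cong₂ _⊝_ (⊝-[-] c x) (⊝-[-] b x) ⟩
      (c ⊖ x) ⊝ (b ⊖ x)         ∎

  -- Subtracting `x ∷ b` means subtracting `x` and then `b`. The cube for `a ⊖ x` moves `b` to the
  -- outside, and the one for `[ x ]` then exchanges `x` with `c`.
  cube-splitʳ : ∀ a x b c → Cube a [ x ] c → Cube (a ⊖ x) (c ⊖ x) b → Cube a (x ∷ b) c
  cube-splitʳ a x b c axc rest = begin
    a ⊝ (x ∷ b) ⊝ (c ⊝ (x ∷ b))
      ≡⟨ ≡.cong₂ _⊝_ (⊝-∷ a x b) (⊝-∷ c x b) ⟩
    a ⊖ x ⊝ b ⊝ (c ⊖ x ⊝ b)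
      ≈⟨ rest ⟨
    a ⊖ x ⊝ (c ⊖ x) ⊝ (b ⊝ (c ⊖ x))
      ≡⟨ ≡.cong (_⊝ (b ⊝ (c ⊖ x))) (≡.cong₂ _⊝_ (⊝-[-] a x) (⊝-[-] c x)) ⟨
    a ⊝ [ x ] ⊝ (c ⊝ [ x ]) ⊝ (b ⊝ (c ⊖ x))
      ≈⟨ ⊝-cong axc ≋-refl ⟩
    a ⊝ c ⊝ ([ x ] ⊝ c) ⊝ (b ⊝ (c ⊖ x))
      ≡⟨ ⊝-++ (a ⊝ c) ([ x ] ⊝ c) (b ⊝ (c ⊖ x)) ⟨
    a ⊝ c ⊝ ((x ∷ b) ⊝ c) ∎

  cube-[]ˡ : ∀ a c → Cube a [] c
  cube-[]ˡ a c = ≋-reflexive (≡.trans (≡.cong₂ _⊝_ (⊝-[] a) (⊝-[] c)) (≡.sym (⊝-[] (a ⊝ c))))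

  -- In these names 1 stands for a single letter and * for an arbitrary word.
  cube-111 : ∀ x y z → Cube [ x ] [ y ] [ z ]
  cube-111 x y z = cube x y z ∷ []

  cube-*11 : ∀ a y z → Cube a [ y ] [ z ]
  cube-*11 []      y z = []
  cube-*11 (x ∷ a) y z = cube-splitˡ x a [ y ] [ z ] (cube-111 x y z) (cube-111 z y x) (cube-111 y z x)
                                     (cube-*11 a (y ∸ x) (z ∸ x))

  cube-1*1 : ∀ x b z → Cube [ x ] b [ z ]
  cube-1*1 x []      z = cube-[]ˡ [ x ] [ z ]
  cube-1*1 x (y ∷ b) z = cube-splitʳ [ x ] y b [ z ] (cube-111 x y z)
                           (≋-sym (cube-1*1 (x ∸ y) b (z ∸ y)))

  cube-**1 : ∀ a b z → Cube a b [ z ]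
  cube-**1 []      b z = []
  cube-**1 (x ∷ a) b z = cube-splitˡ x a b [ z ] (cube-1*1 x b z) (cube-1*1 z b x)
                                     (≋-sym (cube-*11 b x z)) (cube-**1 a (b ⊖ x) (z ∸ x))

  cube-1** : ∀ x b c → Cube [ x ] b c
  cube-1** x []      c = cube-[]ˡ [ x ] c
  cube-1** x (y ∷ b) c = cube-splitʳ [ x ] y b c (≋-sym (cube-1*1 x c y))
                           (≋-sym (cube-1** (x ∸ y) b (c ⊖ y)))

  -- Splitting a letter off the first word calls for cubes with that letter in first or last place,
  -- which is why the cases with single letters come first.
  ⊝-cube : ∀ a b c → Cube a b c
  ⊝-cube []      b c = []
  ⊝-cube (x ∷ a) b c = cube-splitˡ x a b c (cube-1** x b c) (cube-**1 c b x) (cube-**1 b c x)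
                                   (⊝-cube a (b ⊖ x) (c ⊖ x))

  Zero : List A → Set (a ⊔ ℓ)
  Zero = All (_≈ 0#)

  Zero-resp : ∀ {u v} → u ≋ v → Zero u → Zero v
  Zero-resp []      []      = []
  Zero-resp (p ∷ r) (z ∷ s) = trans (sym p) z ∷ Zero-resp r s

  ∸-zeroˡ : ∀ {x} y → x ≈ 0# → (x ∸ y) ≈ 0#
  ∸-zeroˡ y p = trans (∸-cong p refl) (0∸x≈0 y)

  ⊘-zeroˡ : ∀ {x} v → x ≈ 0# → (x ⊘ v) ≈ 0#
  ⊘-zeroˡ []      p = p
  ⊘-zeroˡ (y ∷ v) p = ⊘-zeroˡ v (∸-zeroˡ y p)

  ⊘-identityʳ : ∀ x {z} → Zero z → (x ⊘ z) ≈ x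
  ⊘-identityʳ x []      = refl
  ⊘-identityʳ x {_ ∷ z} (p ∷ r) =
    trans (⊘-cong (trans (∸-cong refl p) (x∸0≈x x)) (≋-refl {z})) (⊘-identityʳ x r)

  Zero-⊖ : ∀ {z} x → Zero z → Zero (z ⊖ x)
  Zero-⊖ x []      = []
  Zero-⊖ x (p ∷ r) = ∸-zeroˡ x p ∷ Zero-⊖ _ r

  ⊝-zeroˡ : ∀ {z} v → Zero z → Zero (z ⊝ v)
  ⊝-zeroˡ v []      = []
  ⊝-zeroˡ v (p ∷ r) = ⊘-zeroˡ v p ∷ ⊝-zeroˡ _ r

  ⊝-identityʳ : ∀ a {z} → Zero z → a ⊝ z ≋ a
  ⊝-identityʳ []      r = []
  ⊝-identityʳ (x ∷ a) r = ⊘-identityʳ x r ∷ ⊝-identityʳ a (Zero-⊖ x r)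

  ⊖-identityʳ : ∀ a {z} → z ≈ 0# → a ⊖ z ≋ a
  ⊖-identityʳ a {z} p = begin
    a ⊖ z     ≡⟨ ⊝-[-] a z ⟨
    a ⊝ [ z ] ≈⟨ ⊝-identityʳ a (p ∷ []) ⟩
    a         ∎

  _≤_ : Rel (List A) (a ⊔ ℓ)
  u ≤ v = Zero (u ⊝ v)

  _~_ : Rel (List A) (a ⊔ ℓ)
  u ~ v = u ≤ v × v ≤ u

  ≤-refl : ∀ u → u ≤ u
  ≤-refl []      = []
  ≤-refl (x ∷ u) = ⊘-zeroˡ u (x∸x≈0 x) ∷
    -- The tail is `u` minus `(x ∸ x) ∷ (u ⊖ (x ∸ x))`; the vanishing letter `x ∸ x` affects neither
    -- copy of `u`.
    Zero-resp (≋-sym (≋-trans (≋-reflexive (⊝-∷ u (x ∸ x) _)) (⊝-cong u⊖0≋u u⊖0≋u))) (≤-refl u)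
    where
    u⊖0≋u : u ⊖ (x ∸ x) ≋ u
    u⊖0≋u = ⊖-identityʳ u (x∸x≈0 x)

  -- Subtracting from the zero word `u ⊝ v` gives zeros, and the cube law turns `u ⊝ v ⊝ (w ⊝ v)`
  -- into `u ⊝ w` minus the zero word `v ⊝ w`.
  ≤-trans : ∀ {u v w} → u ≤ v → v ≤ w → u ≤ w
  ≤-trans {u} {v} {w} uv vw = Zero-resp eq (⊝-zeroˡ (w ⊝ v) uv)
    where
    eq : u ⊝ v ⊝ (w ⊝ v) ≋ u ⊝ w
    eq = begin
      u ⊝ v ⊝ (w ⊝ v) ≈⟨ ⊝-cube u v w ⟩
      u ⊝ w ⊝ (v ⊝ w) ≈⟨ ⊝-identityʳ (u ⊝ w) vw ⟩
      u ⊝ w           ∎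

  ~-isEquivalence : IsEquivalence _~_
  ~-isEquivalence = record
    { refl  = λ {u} → ≤-refl u , ≤-refl u
    ; sym   = λ (p , q) → q , p
    ; trans = λ {u} {v} {w} (p , q) (r , s) → ≤-trans {u} {v} {w} p r , ≤-trans {w} {v} {u} s q
    }

  -- The block `w ⊝ w ⊝ v` consists of zeros, so the whole vanishes exactly when `u ⊝ v` does; this
  -- yields both monotonicity and cancellation.
  ++-⊝-++ˡ : ∀ w u v → (w ++ u) ⊝ (w ++ v) ≋ (w ⊝ w ⊝ v) ++ (u ⊝ v)
  ++-⊝-++ˡ w u v = begin
    (w ++ u) ⊝ (w ++ v)                      ≡⟨ ⊝-++ (w ++ u) w v ⟩
    (w ++ u) ⊝ w ⊝ v                         ≡⟨ ≡.cong (_⊝ v) (++-⊝ w u w) ⟩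
    ((w ⊝ w) ++ (u ⊝ (w ⊝ w))) ⊝ v           ≡⟨ ++-⊝ (w ⊝ w) _ v ⟩
    (w ⊝ w ⊝ v) ++ (u ⊝ (w ⊝ w) ⊝ (v ⊝ (w ⊝ w)))
      ≈⟨ ++⁺ ≋-refl (⊝-cong (⊝-identityʳ u (≤-refl w)) (⊝-identityʳ v (≤-refl w))) ⟩
    (w ⊝ w ⊝ v) ++ (u ⊝ v)                   ∎

  ++-monoʳ-≤ : ∀ w {u v} → u ≤ v → w ++ u ≤ w ++ v
  ++-monoʳ-≤ w {u} {v} p = Zero-resp (≋-sym (++-⊝-++ˡ w u v)) (All.++⁺ (⊝-zeroˡ v (≤-refl w)) p)

  ++-cancelˡ-≤ : ∀ w {u v} → w ++ u ≤ w ++ v → u ≤ v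
  ++-cancelˡ-≤ w {u} {v} p = All.++⁻ʳ (w ⊝ w ⊝ v) (Zero-resp (++-⊝-++ˡ w u v) p)

  ++-congˡ : ∀ w {u v} → u ~ v → w ++ u ~ w ++ v
  ++-congˡ w (p , q) = ++-monoʳ-≤ w p , ++-monoʳ-≤ w q

  -- The proof of `++-comm` rests on this lemma, so it is proved directly. Both inequalities enter:
  -- `w` is diminished by the remainders `v ⊝ u` and `u ⊝ v`, and both must vanish for `w ⊝ w` to
  -- appear.
  ++-congʳ-≤ : ∀ w {u v} → u ~ v → u ++ w ≤ v ++ w
  ++-congʳ-≤ w {u} {v} (p , q) = Zero-resp (≋-sym eq) (All.++⁺ (⊝-zeroˡ w p) (≤-refl w))
    where
    eq : (u ++ w) ⊝ (v ++ w) ≋ (u ⊝ v ⊝ w) ++ (w ⊝ w)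
    eq = begin
      (u ++ w) ⊝ (v ++ w)                ≡⟨ ⊝-++ (u ++ w) v w ⟩
      (u ++ w) ⊝ v ⊝ w                   ≡⟨ ≡.cong (_⊝ w) (++-⊝ u w v) ⟩
      ((u ⊝ v) ++ (w ⊝ (v ⊝ u))) ⊝ w     ≡⟨ ++-⊝ (u ⊝ v) _ w ⟩
      (u ⊝ v ⊝ w) ++ (w ⊝ (v ⊝ u) ⊝ (w ⊝ (u ⊝ v)))
        ≈⟨ ++⁺ ≋-refl (⊝-cong (⊝-identityʳ w q) (⊝-identityʳ w p)) ⟩
      (u ⊝ v ⊝ w) ++ (w ⊝ w)             ∎

  ++-congʳ : ∀ w {u v} → u ~ v → u ++ w ~ v ++ w
  ++-congʳ w {u} {v} (p , q) = ++-congʳ-≤ w {u} {v} (p , q) , ++-congʳ-≤ w {v} {u} (q , p)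

  -- `meet-comm` makes the second letter of the difference vanish: it is the meet of `y` and `x`
  -- minus that of `x` and `y`.
  swap-≤ : ∀ x y → x ∷ y ∷ [] ≤ y ∷ x ∷ []
  swap-≤ x y =
    trans (exchange x y x) (∸-zeroˡ y (x∸x≈0 x)) ∷
    trans (∸-cong (meet-comm y x) refl) (x∸x≈0 (x ∸ (x ∸ y))) ∷ []

  module ~ = IsEquivalence ~-isEquivalence

  ∷-~-∷ʳ : ∀ x v → x ∷ v ~ v ++ [ x ]
  ∷-~-∷ʳ x []      = ~.refl {[ x ]}
  ∷-~-∷ʳ x (y ∷ v) = ~.trans {x ∷ y ∷ v} {y ∷ x ∷ v} {y ∷ v ++ [ x ]}
    (++-congʳ v {x ∷ y ∷ []} {y ∷ x ∷ []} (swap-≤ x y , swap-≤ y x))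
    (++-congˡ [ y ] {x ∷ v} {v ++ [ x ]} (∷-~-∷ʳ x v))

  ++-comm : ∀ u v → u ++ v ~ v ++ u
  ++-comm []      v = ≡.subst (v ~_) (≡.sym (++-identityʳ v)) (~.refl {v})
  ++-comm (x ∷ u) v = ~.trans {x ∷ u ++ v} {x ∷ v ++ u} {v ++ x ∷ u}
    (++-congˡ [ x ] {u ++ v} {v ++ u} (++-comm u v))
    (≡.subst ((x ∷ v ++ u) ~_) (++-assoc v [ x ] u) (++-congʳ u {x ∷ v} {v ++ [ x ]} (∷-~-∷ʳ x v)))

  ++-isCommutativeMonoid : IsCommutativeMonoid _~_ _++_ []
  ++-isCommutativeMonoid = record
    { isMonoid = record
      { isSemigroup = record
        { isMagma = record
          { isEquivalence = ~-isEquivalence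
          ; ∙-cong = λ {u} {u′} {v} {v′} p q →
              ~.trans {u ++ v} {u′ ++ v} {u′ ++ v′} (++-congʳ v {u} {u′} p) (++-congˡ u′ {v} {v′} q)
          }
        ; assoc = λ u v w → ~.reflexive (++-assoc u v w)
        }
      ; identity = (λ u → ~.refl {u}) , (λ u → ~.reflexive (++-identityʳ u))
      }
    ; comm = ++-comm
    }

  cone : Cone a (a ⊔ ℓ)
  cone = record
    { Carrier = List A ; _≤_ = _≤_ ; _+_ = _++_ ; 0# = [] ; _∸_ = _⊝_
    ; ≤-refl = ≤-refl
    ; ≤-trans = λ {u} {v} {w} → ≤-trans {u} {v} {w}
    ; +-isCommutativeMonoid = ++-isCommutativeMonoid
    ; +-monoʳ-≤ = λ w {u} {v} → ++-monoʳ-≤ w {u} {v}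
    ; +-cancelˡ-≤ = λ w {u} {v} → ++-cancelˡ-≤ w {u} {v}
    ; 0≤x = λ _ → []
    -- Residuation is the identity between `u ⊝ (v ++ w)` and `u ⊝ v ⊝ w`.
    ; ∸≤⇒≤+ = λ u v w → ≡.subst Zero (≡.sym (⊝-++ u v w))
    ; ≤+⇒∸≤ = λ u v w → ≡.subst Zero (⊝-++ u v w)
    -- By `++-⊝`, subtracting `u` leaves `v ⊝ u`, zero by hypothesis, followed by `u ⊝ v` minus
    -- itself.
    ; y+[x∸y]≤x = λ u v v≤u →
        ≡.subst Zero (≡.sym (++-⊝ v (u ⊝ v) u)) (All.++⁺ v≤u (≤-refl (u ⊝ v)))
    }

-- Lattice-ordered groups of differences

record JoinOrderedGroup (c ℓ : Level) : Set (lsuc (c ⊔ ℓ)) where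
  infix 4 _≈_ _≤_
  infixl 6 _+_
  infixl 7 _∨_
  field
    Carrier : Set c
    _≈_ _≤_ : Rel Carrier ℓ
    _+_ _∨_ : Op₂ Carrier
    0#      : Carrier
    -_      : Op₁ Carrier
    +-isAbelianGroup : IsAbelianGroup _≈_ _+_ 0# -_
    isPartialOrder   : IsPartialOrder _≈_ _≤_
    +-monoʳ-≤ : ∀ z {x y} → x ≤ y → z + x ≤ z + y
    supremum  : Supremum _≤_ _∨_

module JoinOrderedGroupProperties {c ℓ} (G : JoinOrderedGroup c ℓ) where
  open JoinOrderedGroup G
  open IsPartialOrder isPartialOrder using (antisym)
    renaming (reflexive to ≤-reflexive; refl to ≤-refl; trans to ≤-trans)

  abelianGroup : AbelianGroup c ℓ
  abelianGroup = record { isAbelianGroup = +-isAbelianGroup }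

  open AbelianGroup abelianGroup using (refl; sym; trans; isCommutativeMonoid)
    renaming (comm to +-comm; inverseˡ to -‿inverseˡ; inverseʳ to -‿inverseʳ; identityʳ to +-identityʳ)
  open AbelianGroupProperties abelianGroup
    using (⁻¹-involutive; \\-leftDividesˡ; \\-leftDividesʳ)

  poset : Poset c ℓ ℓ
  poset = record { isPartialOrder = isPartialOrder }

  open PosetReasoning poset

  infixl 7 _∧_

  _∧_ : Op₂ Carrier
  x ∧ y = - (- x ∨ - y)

  x≤x∨y : ∀ x y → x ≤ x ∨ y
  x≤x∨y x y = proj₁ (supremum x y)

  y≤x∨y : ∀ x y → y ≤ x ∨ y
  y≤x∨y x y = proj₁ (proj₂ (supremum x y))

  ∨-least : ∀ {x y z} → x ≤ z → y ≤ z → x ∨ y ≤ z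
  ∨-least {x} {y} {z} = proj₂ (proj₂ (supremum x y)) z

  +-monoˡ-≤ : ∀ z {x y} → x ≤ y → x + z ≤ y + z
  +-monoˡ-≤ z {x} {y} x≤y = begin
    x + z ≈⟨ +-comm x z ⟩
    z + x ≤⟨ +-monoʳ-≤ z x≤y ⟩
    z + y ≈⟨ +-comm z y ⟩
    y + z ∎

  +-mono-≤ : ∀ {x y u v} → x ≤ y → u ≤ v → x + u ≤ y + v
  +-mono-≤ {y = y} {u} x≤y u≤v = ≤-trans (+-monoˡ-≤ u x≤y) (+-monoʳ-≤ y u≤v)

  z+x≤y⇒x≤-z+y : ∀ {x y} z → z + x ≤ y → x ≤ - z + y
  z+x≤y⇒x≤-z+y {x} {y} z p = begin
    x             ≈⟨ \\-leftDividesʳ z x ⟨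
    - z + (z + x) ≤⟨ +-monoʳ-≤ (- z) p ⟩
    - z + y       ∎

  x≤-z+y⇒z+x≤y : ∀ {x y} z → x ≤ - z + y → z + x ≤ y
  x≤-z+y⇒z+x≤y {x} {y} z p = begin
    z + x         ≤⟨ +-monoʳ-≤ z p ⟩
    z + (- z + y) ≈⟨ \\-leftDividesˡ z y ⟩
    y             ∎

  y≤z+x⇒-z+y≤x : ∀ {x y} z → y ≤ z + x → - z + y ≤ x
  y≤z+x⇒-z+y≤x {x} {y} z p = begin
    - z + y       ≤⟨ +-monoʳ-≤ (- z) p ⟩
    - z + (z + x) ≈⟨ \\-leftDividesʳ z x ⟩
    x             ∎

  -z+y≤x⇒y≤z+x : ∀ {x y} z → - z + y ≤ x → y ≤ z + x
  -z+y≤x⇒y≤z+x {x} {y} z p = begin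
    y             ≈⟨ \\-leftDividesˡ z y ⟨
    z + (- z + y) ≤⟨ +-monoʳ-≤ z p ⟩
    z + x         ∎

  +-cancelˡ-≤ : ∀ z {x y} → z + x ≤ z + y → x ≤ y
  +-cancelˡ-≤ z {x} {y} p = ≤-trans (z+x≤y⇒x≤-z+y z p) (≤-reflexive (\\-leftDividesʳ z y))

  neg-anti-≤ : ∀ {x y} → x ≤ y → - y ≤ - x
  neg-anti-≤ {x} {y} p = begin
    - y             ≈⟨ +-identityʳ (- y) ⟨
    - y + 0#        ≤⟨ y≤z+x⇒-z+y≤x y 0≤y-x ⟩
    - x             ∎
    where
    0≤y-x : 0# ≤ y + - x
    0≤y-x = begin
      0#      ≈⟨ -‿inverseʳ x ⟨
      x + - x ≤⟨ +-monoˡ-≤ (- x) p ⟩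
      y + - x ∎

  infimum : Infimum _≤_ _∧_
  infimum x y =
      ≤-trans (neg-anti-≤ (x≤x∨y (- x) (- y))) (≤-reflexive (⁻¹-involutive x))
    , ≤-trans (neg-anti-≤ (y≤x∨y (- x) (- y))) (≤-reflexive (⁻¹-involutive y))
    , λ z z≤x z≤y → ≤-trans (≤-reflexive (sym (⁻¹-involutive z)))
                            (neg-anti-≤ (∨-least (neg-anti-≤ z≤x) (neg-anti-≤ z≤y)))

  x∧y≤x : ∀ x y → x ∧ y ≤ x
  x∧y≤x x y = proj₁ (infimum x y)

  x∧y≤y : ∀ x y → x ∧ y ≤ y
  x∧y≤y x y = proj₁ (proj₂ (infimum x y))

  ∧-greatest : ∀ {x y z} → z ≤ x → z ≤ y → z ≤ x ∧ y
  ∧-greatest {x} {y} {z} = proj₂ (proj₂ (infimum x y)) z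

  lattice : Lattice c ℓ ℓ
  lattice = record { isLattice = record
    { isPartialOrder = isPartialOrder ; supremum = supremum ; infimum = infimum } }

  -- Translation by `z` is an order automorphism, with inverse the translation by `- z`, so it
  -- preserves joins.
  +-distribˡ-∨ : AD._DistributesOverˡ_ _≈_ _+_ _∨_
  +-distribˡ-∨ z x y = antisym
    (x≤-z+y⇒z+x≤y z (∨-least (z+x≤y⇒x≤-z+y z (x≤x∨y _ _)) (z+x≤y⇒x≤-z+y z (y≤x∨y _ _))))
    (∨-least (+-monoʳ-≤ z (x≤x∨y x y)) (+-monoʳ-≤ z (y≤x∨y x y)))

  +-distribˡ-∧ : AD._DistributesOverˡ_ _≈_ _+_ _∧_
  +-distribˡ-∧ z x y = antisym
    (∧-greatest (+-monoʳ-≤ z (x∧y≤x x y)) (+-monoʳ-≤ z (x∧y≤y x y)))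
    (-z+y≤x⇒y≤z+x z (∧-greatest (y≤z+x⇒-z+y≤x z (x∧y≤x _ _)) (y≤z+x⇒-z+y≤x z (x∧y≤y _ _))))

  open LatticeProperties lattice using (isAlgLattice)
  open IsLattice isAlgLattice using (∨-cong; ∧-cong)

  +-distribʳ : ∀ {_∙_} → AD.Congruent₂ _≈_ _∙_ →
               AD._DistributesOverˡ_ _≈_ _+_ _∙_ → AD._DistributesOverʳ_ _≈_ _+_ _∙_
  +-distribʳ ∙-cong distribˡ z x y =
    trans (+-comm _ z) (trans (distribˡ z x y) (∙-cong (+-comm z x) (+-comm z y)))

  +-distrib-∨ : AD._DistributesOver_ _≈_ _+_ _∨_
  +-distrib-∨ = +-distribˡ-∨ , +-distribʳ ∨-cong +-distribˡ-∨

  +-distrib-∧ : AD._DistributesOver_ _≈_ _+_ _∧_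
  +-distrib-∧ = +-distribˡ-∧ , +-distribʳ ∧-cong +-distribˡ-∧

  -- With s the join of y and z, w its meet with x and d the right-hand side,
  -- w + y ≤ (x ∧ y) + s ≤ d + s and likewise w + z ≤ d + s, so w + s ≤ d + s.
  ∧-distribˡ-∨-≤ : ∀ x y z → x ∧ (y ∨ z) ≤ (x ∧ y) ∨ (x ∧ z)
  ∧-distribˡ-∨-≤ x y z = +-cancelˡ-≤ s (begin
    s + w              ≈⟨ +-comm s w ⟩
    w + s              ≈⟨ +-distribˡ-∨ w y z ⟩
    (w + y) ∨ (w + z)  ≤⟨ ∨-least (bound y (x≤x∨y y z) (x≤x∨y _ _)) (bound z (y≤x∨y y z) (y≤x∨y _ _)) ⟩
    s + d              ∎)
    where
    s = y ∨ z
    w = x ∧ s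
    d = (x ∧ y) ∨ (x ∧ z)
    bound : ∀ t → t ≤ s → x ∧ t ≤ d → w + t ≤ s + d
    bound t t≤s x∧t≤d = begin
      w + t              ≤⟨ ∧-greatest (+-mono-≤ (x∧y≤x x s) t≤s) (+-monoˡ-≤ t (x∧y≤y x s)) ⟩
      (x + s) ∧ (s + t)  ≈⟨ ∧-cong (+-comm x s) refl ⟩
      (s + x) ∧ (s + t)  ≈⟨ +-distribˡ-∧ s x t ⟨
      s + (x ∧ t)        ≤⟨ +-monoʳ-≤ s x∧t≤d ⟩
      s + d              ∎

  distributiveLattice : DistributiveLattice c ℓ ℓ
  distributiveLattice = record { isDistributiveLattice = record
    { isLattice = Lattice.isLattice lattice
    ; ∧-distribˡ-∨ = λ x y z → antisym (∧-distribˡ-∨-≤ x y z)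
        (∧-greatest (∨-least (x∧y≤x x y) (x∧y≤x x z))
                    (∨-least (≤-trans (x∧y≤y x y) (x≤x∨y y z)) (≤-trans (x∧y≤y x z) (y≤x∨y y z))))
    } }

  isDistributiveLattice : IsDistributiveLattice _≈_ _∨_ _∧_
  isDistributiveLattice = record
    { isLattice = isAlgLattice ; ∨-distrib-∧ = ∨-distrib-∧ ; ∧-distrib-∨ = ∧-distrib-∨ }
    where open DistributiveLatticeProperties distributiveLattice

  ≤⇒meet : ∀ {x y} → x ≤ y → LeqFromMeet _≈_ _∧_ x y
  ≤⇒meet x≤y = antisym (x∧y≤x _ _) (∧-greatest ≤-refl x≤y)

  meet⇒≤ : ∀ {x y} → LeqFromMeet _≈_ _∧_ x y → x ≤ y
  meet⇒≤ {x} {y} p = ≤-trans (≤-reflexive (sym p)) (x∧y≤y x y)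

  module Unital (1# : Carrier) (0≤1 : 0# ≤ 1#)
                (unitBound : ∀ x → Σ ℕ λ n → times _+_ 0# n (- 1#) ≤ x × x ≤ times _+_ 0# n 1#) where

    ulm : ULM c ℓ
    ulm = record
      { isDistributiveLattice = isDistributiveLattice
      ; +-isCommutativeMonoid = isCommutativeMonoid
      ; +-distrib-∨ = +-distrib-∨
      ; +-distrib-∧ = +-distrib-∧
      ; -1+1≈0 = -‿inverseˡ 1#
      ; 0≤1 = ≤⇒meet 0≤1
      ; unitBound = λ x → let n , lo , hi = unitBound x in n , ≤⇒meet lo , ≤⇒meet hi
      }

    isULGReduct : IsULGReduct ulm
    isULGReduct = -_ , record
      { isDistributiveLattice = isDistributiveLattice
      ; +-isAbelianGroup = +-isAbelianGroup
      ; +-distrib-∨ = +-distrib-∨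
      ; +-distrib-∧ = +-distrib-∧
      ; 0≤1 = ≤⇒meet 0≤1
      ; unitBound = λ x → let n , _ , hi = unitBound x in n , ≤⇒meet hi
      } , refl

-- Positive cones and their groups of differences

module ConeProperties {c ℓ} (C : Cone c ℓ) where
  open Cone C
  open IsCommutativeMonoid +-isCommutativeMonoid using (isEquivalence)
    renaming (comm to +-comm; identityʳ to +-identityʳ)

  poset : Poset c ℓ ℓ
  poset = record { isPartialOrder = record
    { isPreorder = record { isEquivalence = isEquivalence ; reflexive = proj₁ ; trans = ≤-trans }
    ; antisym = _,_ } }

  open PosetReasoning poset

  +-monoˡ-≤ : ∀ z {x y} → x ≤ y → x + z ≤ y + z
  +-monoˡ-≤ z {x} {y} x≤y = begin
    x + z ≈⟨ +-comm x z ⟩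
    z + x ≤⟨ +-monoʳ-≤ z x≤y ⟩
    z + y ≈⟨ +-comm z y ⟩
    y + z ∎

  x≤x+y : ∀ x y → x ≤ x + y
  x≤x+y x y = ≤-trans (proj₂ (+-identityʳ x)) (+-monoʳ-≤ x (0≤x y))

  y≤x+y : ∀ x y → y ≤ x + y
  y≤x+y x y = ≤-trans (x≤x+y y x) (proj₁ (+-comm y x))

  x≤y+[x∸y] : ∀ x y → x ≤ y + (x ∸ y)
  x≤y+[x∸y] x y = ∸≤⇒≤+ x y (x ∸ y) (≤-refl (x ∸ y))

  infixl 7 _⋎_

  _⋎_ : Op₂ Carrier
  x ⋎ y = y + (x ∸ y)

  y≤x⋎y : ∀ x y → y ≤ x ⋎ y
  y≤x⋎y x y = x≤x+y y (x ∸ y)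

  ⋎-least : ∀ {x y z} → x ≤ z → y ≤ z → x ⋎ y ≤ z
  ⋎-least {x} {y} {z} x≤z y≤z =
    ≤-trans (+-monoʳ-≤ y (≤+⇒∸≤ x y (z ∸ y) (≤-trans x≤z (x≤y+[x∸y] z y)))) (y+[x∸y]≤x z y y≤z)

  -- Either hypothesis puts `w` below `z`, so `z` is `w + (z ∸ w)`, and cancelling `w` leaves the
  -- universal property of the join.
  +⋎-least : ∀ {x y z} w → w + x ≤ z → w + y ≤ z → w + x ⋎ y ≤ z
  +⋎-least {x} {y} {z} w wx≤z wy≤z =
    ≤-trans (+-monoʳ-≤ w (⋎-least (shift wx≤z) (shift wy≤z))) (y+[x∸y]≤x z w w≤z)
    where
    w≤z : w ≤ z
    w≤z = ≤-trans (x≤x+y w x) wx≤z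
    shift : ∀ {t} → w + t ≤ z → t ≤ z ∸ w
    shift p = +-cancelˡ-≤ w (≤-trans p (x≤y+[x∸y] z w))

  x∸[x∸y]≤x : ∀ x y → x ∸ (x ∸ y) ≤ x
  x∸[x∸y]≤x x y = ≤+⇒∸≤ x (x ∸ y) x (y≤x+y (x ∸ y) x)

  x∸[x∸y]≤y : ∀ x y → x ∸ (x ∸ y) ≤ y
  x∸[x∸y]≤y x y = ≤+⇒∸≤ x (x ∸ y) y (≤-trans (x≤y+[x∸y] x y) (proj₁ (+-comm y (x ∸ y))))

  -- As `z ≤ x`, `x` is `z + (x ∸ z)`, which dominates `z + (x ∸ y)` because `z ≤ y`. Comparing this
  -- with `x ≤ (x ∸ y) + (x ∸ (x ∸ y))` and cancelling `x ∸ y` gives the claim.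
  x∸[x∸y]-greatest : ∀ {x y z} → z ≤ x → z ≤ y → z ≤ x ∸ (x ∸ y)
  x∸[x∸y]-greatest {x} {y} {z} z≤x z≤y = +-cancelˡ-≤ (x ∸ y)
    (≤-trans (≤-trans (+-monoˡ-≤ z x∸y≤x∸z) (proj₁ (+-comm (x ∸ z) z)))
             (≤-trans (y+[x∸y]≤x x z z≤x) (x≤y+[x∸y] x (x ∸ y))))
    where
    x∸y≤x∸z : x ∸ y ≤ x ∸ z
    x∸y≤x∸z = ≤+⇒∸≤ x y (x ∸ z) (≤-trans (x≤y+[x∸y] x z) (+-monoˡ-≤ (x ∸ z) z≤y))

module Differences {c ℓ} (C : Cone c ℓ) where
  open Cone C
  open ConeProperties C
  open PosetReasoning poset

  +-commutativeMonoid : CommutativeMonoid c ℓ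
  +-commutativeMonoid = record { isCommutativeMonoid = +-isCommutativeMonoid }

  open CommutativeMonoid +-commutativeMonoid using (refl) renaming (comm to +-comm)
  open CommutativeMonoidSolver +-commutativeMonoid using (solve; _⊜_; _⊕_; id)

  -- The record sits in the join of both levels because essential
  -- surjectivity asks for a ULM whose carrier and equality share one level.
  record Difference : Set (c ⊔ ℓ) where
    constructor _−_
    field
      pos neg : Carrier

  infix 4 _⊑_ _≃_
  infixl 6 _⊞_

  _⊑_ : Rel Difference ℓ
  (a − b) ⊑ (c − d) = a + d ≤ c + b

  _≃_ : Rel Difference ℓ
  x ≃ y = x ⊑ y × y ⊑ x

  _⊞_ : Op₂ Difference
  (a − b) ⊞ (c − d) = (a + c) − (b + d)

  ⊟_ : Op₁ Difference
  ⊟ (a − b) = b − a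

  -- Both arguments are brought to the common subtrahend `b + d`.
  _∨_ : Op₂ Difference
  (a − b) ∨ (c − d) = ((a + d) ⋎ (c + b)) − (b + d)

  ⊑-refl : ∀ {x} → x ⊑ x
  ⊑-refl {a − b} = ≤-refl (a + b)

  ⊑-trans : ∀ {x y z} → x ⊑ y → y ⊑ z → x ⊑ z
  ⊑-trans {a − b} {c − d} {e − f} p q = +-cancelˡ-≤ d (begin
    d + (a + f)   ≈⟨ solve 3 (λ a d f → d ⊕ (a ⊕ f) ⊜ (a ⊕ d) ⊕ f) refl a d f ⟩
    (a + d) + f   ≤⟨ +-monoˡ-≤ f p ⟩
    (c + b) + f   ≈⟨ solve 3 (λ b c f → (c ⊕ b) ⊕ f ⊜ (c ⊕ f) ⊕ b) refl b c f ⟩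
    (c + f) + b   ≤⟨ +-monoˡ-≤ b q ⟩
    (e + d) + b   ≈⟨ solve 3 (λ b d e → (e ⊕ d) ⊕ b ⊜ d ⊕ (e ⊕ b)) refl b d e ⟩
    d + (e + b)   ∎)

  ≃-isEquivalence : IsEquivalence _≃_
  ≃-isEquivalence = record
    { refl  = λ {x} → ⊑-refl {x} , ⊑-refl {x}
    ; sym   = λ (p , q) → q , p
    ; trans = λ {x} {y} {z} (p , q) (r , s) → ⊑-trans {x} {y} {z} p r , ⊑-trans {z} {y} {x} s q
    }

  ⊞-monoʳ-⊑ : ∀ z {x y} → x ⊑ y → z ⊞ x ⊑ z ⊞ y
  ⊞-monoʳ-⊑ (e − f) {a − b} {c − d} p = begin
    (e + a) + (f + d) ≈⟨ shuffle a d ⟩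
    (e + f) + (a + d) ≤⟨ +-monoʳ-≤ (e + f) p ⟩
    (e + f) + (c + b) ≈⟨ shuffle c b ⟨
    (e + c) + (f + b) ∎
    where
    shuffle : ∀ s t → (e + s) + (f + t) ≈ (e + f) + (s + t)
    shuffle = solve 4 (λ e f s t → (e ⊕ s) ⊕ (f ⊕ t) ⊜ (e ⊕ f) ⊕ (s ⊕ t)) refl e f

  ⊞-comm : ∀ x y → x ⊞ y ≃ y ⊞ x
  ⊞-comm (a − b) (c − d) =
    solve 4 (λ a b c d → (a ⊕ c) ⊕ (d ⊕ b) ⊜ (c ⊕ a) ⊕ (b ⊕ d)) refl a b c d

  ⊞-congʳ : ∀ z {x y} → x ≃ y → z ⊞ x ≃ z ⊞ y
  ⊞-congʳ z {x} {y} (p , q) = ⊞-monoʳ-⊑ z {x} {y} p , ⊞-monoʳ-⊑ z {y} {x} q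

  module ≃ = IsEquivalence ≃-isEquivalence

  ⊞-isAbelianGroup : IsAbelianGroup _≃_ _⊞_ (0# − 0#) ⊟_
  ⊞-isAbelianGroup = record
    { isGroup = record
      { isMonoid = record
        { isSemigroup = record
          { isMagma = record
            { isEquivalence = ≃-isEquivalence
            ; ∙-cong = λ {x} {y} {u} {v} p q →
                ≃.trans {x ⊞ u} {x ⊞ v} {y ⊞ v} (⊞-congʳ x {u} {v} q)
                (≃.trans {x ⊞ v} {v ⊞ x} {y ⊞ v} (⊞-comm x v)
                (≃.trans {v ⊞ x} {v ⊞ y} {y ⊞ v} (⊞-congʳ v {x} {y} p) (⊞-comm v y)))
            }
          ; assoc = λ (a − b) (c − d) (e − f) →
              solve 6 (λ a b c d e f → ((a ⊕ c) ⊕ e) ⊕ (b ⊕ (d ⊕ f)) ⊜ (a ⊕ (c ⊕ e)) ⊕ ((b ⊕ d) ⊕ f))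
                    refl a b c d e f
          }
        ; identity =
            (λ (a − b) → solve 2 (λ a b → (id ⊕ a) ⊕ b ⊜ a ⊕ (id ⊕ b)) refl a b)
          , (λ (a − b) → solve 2 (λ a b → (a ⊕ id) ⊕ b ⊜ a ⊕ (b ⊕ id)) refl a b)
        }
      ; inverse =
          (λ (a − b) → solve 2 (λ a b → (b ⊕ a) ⊕ id ⊜ id ⊕ (a ⊕ b)) refl a b)
        , (λ (a − b) → solve 2 (λ a b → (a ⊕ b) ⊕ id ⊜ id ⊕ (b ⊕ a)) refl a b)
      ; ⁻¹-cong = λ {(a − b)} {(c − d)} (p , q) →
            ≤-trans (proj₁ (+-comm b c)) (≤-trans q (proj₁ (+-comm a d)))
          , ≤-trans (proj₁ (+-comm d a)) (≤-trans p (proj₁ (+-comm c b)))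
      }
    ; comm = ⊞-comm
    }

  ∨-supremum : Supremum _⊑_ _∨_
  ∨-supremum (a − b) (c − d) = left , right , least
    where
    j = (a + d) ⋎ (c + b)
    left : a + (b + d) ≤ j + b
    left = begin
      a + (b + d)   ≈⟨ solve 3 (λ a b d → a ⊕ (b ⊕ d) ⊜ (a ⊕ d) ⊕ b) refl a b d ⟩
      (a + d) + b   ≤⟨ +-monoˡ-≤ b (x≤y+[x∸y] _ _) ⟩
      j + b         ∎
    right : c + (b + d) ≤ j + d
    right = begin
      c + (b + d)   ≈⟨ solve 3 (λ b c d → c ⊕ (b ⊕ d) ⊜ (c ⊕ b) ⊕ d) refl b c d ⟩
      (c + b) + d   ≤⟨ +-monoˡ-≤ d (y≤x⋎y _ _) ⟩
      j + d         ∎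
    least : ∀ z → (a − b) ⊑ z → (c − d) ⊑ z → (j − (b + d)) ⊑ z
    least (e − f) p q = begin
      j + f  ≈⟨ +-comm j f ⟩
      f + j  ≤⟨ +⋎-least f
                 (begin
                   f + (a + d)   ≈⟨ solve 3 (λ a d f → f ⊕ (a ⊕ d) ⊜ (a ⊕ f) ⊕ d) refl a d f ⟩
                   (a + f) + d   ≤⟨ +-monoˡ-≤ d p ⟩
                   (e + b) + d   ≈⟨ solve 3 (λ b d e → (e ⊕ b) ⊕ d ⊜ e ⊕ (b ⊕ d)) refl b d e ⟩
                   e + (b + d)   ∎)
                 (begin
                   f + (c + b)   ≈⟨ solve 3 (λ b c f → f ⊕ (c ⊕ b) ⊜ (c ⊕ f) ⊕ b) refl b c f ⟩
                   (c + f) + b   ≤⟨ +-monoˡ-≤ b q ⟩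
                   (e + d) + b   ≈⟨ solve 3 (λ b d e → (e ⊕ d) ⊕ b ⊜ e ⊕ (b ⊕ d)) refl b d e ⟩
                   e + (b + d)   ∎) ⟩
      e + (b + d) ∎

  joinOrderedGroup : JoinOrderedGroup (c ⊔ ℓ) ℓ
  joinOrderedGroup = record
    { _≈_ = _≃_ ; _≤_ = _⊑_ ; _+_ = _⊞_ ; _∨_ = _∨_ ; 0# = 0# − 0# ; -_ = ⊟_
    ; +-isAbelianGroup = ⊞-isAbelianGroup
    ; isPartialOrder = record
      { isPreorder = record
        { isEquivalence = ≃-isEquivalence
        ; reflexive = proj₁
        ; trans = λ {x} {y} {z} → ⊑-trans {x} {y} {z}
        }
      ; antisym = _,_
      }
    ; +-monoʳ-≤ = λ z {x} {y} → ⊞-monoʳ-⊑ z {x} {y}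
    ; supremum = ∨-supremum
    }

  ι : Carrier → Difference
  ι x = x − 0#

  times-ι : ∀ n x → times _⊞_ (0# − 0#) n (ι x) ≃ ι (times _+_ 0# n x)
  times-ι zero    x = ≃.refl {0# − 0#}
  times-ι (suc n) x = ≃.trans {ι x ⊞ times _⊞_ (0# − 0#) n (ι x)} {ι x ⊞ ι t} {ι (x + t)}
    (⊞-congʳ (ι x) {times _⊞_ (0# − 0#) n (ι x)} {ι t} (times-ι n x))
    (solve 2 (λ x t → (x ⊕ t) ⊕ id ⊜ (x ⊕ t) ⊕ (id ⊕ id)) refl x t)
    where t = times _+_ 0# n x

  times-⊟ι : ∀ n x → times _⊞_ (0# − 0#) n (⊟ ι x) ≃ ⊟ ι (times _+_ 0# n x)
  times-⊟ι zero    x = ≃.refl {0# − 0#}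
  times-⊟ι (suc n) x = ≃.trans {⊟ ι x ⊞ times _⊞_ (0# − 0#) n (⊟ ι x)} {⊟ ι x ⊞ ⊟ ι t} {⊟ ι (x + t)}
    (⊞-congʳ (⊟ ι x) {times _⊞_ (0# − 0#) n (⊟ ι x)} {⊟ ι t} (times-⊟ι n x))
    (solve 2 (λ x t → (id ⊕ id) ⊕ (x ⊕ t) ⊜ id ⊕ (x ⊕ t)) refl x t)
    where t = times _+_ 0# n x

  -- A multiple of `e` above `a + b` bounds both `a` and `b`, hence `a − b` from both sides.
  unitBound : ∀ e → (∀ x → Σ ℕ λ n → x ≤ times _+_ 0# n e) →
              ∀ x → Σ ℕ λ n → times _⊞_ (0# − 0#) n (⊟ ι e) ⊑ x × x ⊑ times _⊞_ (0# − 0#) n (ι e)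
  unitBound e bound (a − b) with bound (a + b)
  ... | n , a+b≤t = n ,
      ⊑-trans {times _⊞_ (0# − 0#) n (⊟ ι e)} {⊟ ι t} {a − b} (proj₁ (times-⊟ι n e)) lower ,
      ⊑-trans {a − b} {ι t} {times _⊞_ (0# − 0#) n (ι e)} upper (proj₂ (times-ι n e))
    where
    t = times _+_ 0# n e
    lower : 0# + b ≤ a + t
    lower = begin
      0# + b ≤⟨ +-monoˡ-≤ b (0≤x a) ⟩
      a + b  ≤⟨ a+b≤t ⟩
      t      ≤⟨ y≤x+y a t ⟩
      a + t  ∎
    upper : a + 0# ≤ t + b
    upper = begin
      a + 0# ≤⟨ +-monoʳ-≤ a (0≤x b) ⟩
      a + b  ≤⟨ a+b≤t ⟩
      t      ≤⟨ x≤x+y t b ⟩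
      t + b  ∎

-- From MV-algebras to unital ℓ-groups

module UnitInterval {c ℓ} (M : ULM c ℓ) where
  open ULM M
  private
    module Γ = RawMVM (Γ M)

  -- The elements are explicit arguments since equality in `Γ M` only sees first components, from
  -- which unification cannot recover the membership proofs.
  ⊕-cong : ∀ x x′ y y′ → x Γ.≈ x′ → y Γ.≈ y′ → (x Γ.⊕ y) Γ.≈ (x′ Γ.⊕ y′)
  ⊕-cong _ _ _ _ p q = ∧-cong (+-cong p q) refl

  ⊙-cong : ∀ x x′ y y′ → x Γ.≈ x′ → y Γ.≈ y′ → (x Γ.⊙ y) Γ.≈ (x′ Γ.⊙ y′)
  ⊙-cong _ _ _ _ p q = ∨-cong (+-cong (+-cong p q) refl) refl

module _ {c₁ ℓ₁ c₂ ℓ₂} (M : ULM c₁ ℓ₁) (B : RawMVM c₂ ℓ₂) where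
  private
    module M = ULM M
    module Γ = RawMVM (Γ M)
    module B = RawMVM B
  open UnitInterval M

  bijective⇒isomorphism : (h : MVM-homomorphism B (Γ M)) →
    (∀ {x y} → MVM-homomorphism.⟦ h ⟧ x Γ.≈ MVM-homomorphism.⟦ h ⟧ y → x B.≈ y) →
    (g : Γ.Carrier → B.Carrier) → (∀ x → MVM-homomorphism.⟦ h ⟧ (g x) Γ.≈ x) →
    MVM-isomorphism (Γ M) B
  bijective⇒isomorphism h injective g h∘g = record
    { to = record
      { ⟦_⟧   = g
      ; cong  = λ {x} {y} p → injective (M.trans (h∘g x) (M.trans p (M.sym (h∘g y))))
      ; hom-⊕ = hom₂ Γ._⊕_ B._⊕_ ⊕-cong hom-⊕
      ; hom-⊙ = hom₂ Γ._⊙_ B._⊙_ ⊙-cong hom-⊙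
      ; hom-∨ = hom₂ Γ._∨_ B._∨_ (λ _ _ _ _ → M.∨-cong) hom-∨
      ; hom-∧ = hom₂ Γ._∧_ B._∧_ (λ _ _ _ _ → M.∧-cong) hom-∧
      ; hom-0 = injective (M.trans (h∘g Γ.0#) (M.sym hom-0))
      ; hom-1 = injective (M.trans (h∘g Γ.1#) (M.sym hom-1))
      }
    ; from = h
    ; from∘to = h∘g
    ; to∘from = λ y → injective (h∘g ⟦ y ⟧)
    }
    where
    open MVM-homomorphism h
    hom₂ : (_∙_ : Op₂ Γ.Carrier) (_∘_ : Op₂ B.Carrier) →
           (∀ x x′ y y′ → x Γ.≈ x′ → y Γ.≈ y′ → (x ∙ y) Γ.≈ (x′ ∙ y′)) →
           (∀ x y → ⟦ x ∘ y ⟧ Γ.≈ (⟦ x ⟧ ∙ ⟦ y ⟧)) →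
           ∀ x y → g (x ∙ y) B.≈ (g x ∘ g y)
    hom₂ _∙_ _∘_ ∙-cong hom x y = injective (M.trans (h∘g (x ∙ y))
      (M.sym (M.trans (hom (g x) (g y)) (∙-cong _ _ _ _ (h∘g x) (h∘g y)))))

module MVAlgebraProperties {c ℓ} (B : MVAlgebra c ℓ) where
  open MVAlgebra B
  open IsMVAlgebra isMVAlgebra
  open MVDerived _⊕_ ¬_ 0#
  open IsCommutativeMonoid ⊕-isCommutativeMonoid
    using (isEquivalence; setoid; refl; sym; trans)
    renaming (∙-cong to ⊕-cong; ∙-congˡ to ⊕-congˡ; ∙-congʳ to ⊕-congʳ;
              assoc to ⊕-assoc; comm to ⊕-comm; identityˡ to ⊕-identityˡ; identityʳ to ⊕-identityʳ)
  open SetoidReasoning setoid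

  _∸_ : Op₂ Carrier
  x ∸ y = ¬ ((¬ x) ⊕ y)

  ∸-cong : ∀ {x x′ y y′} → x ≈ x′ → y ≈ y′ → (x ∸ y) ≈ (x′ ∸ y′)
  ∸-cong p q = ¬-cong (⊕-cong (¬-cong p) q)

  x⊕1≈1 : ∀ x → (x ⊕ 1#) ≈ 1#
  x⊕1≈1 x = trans (⊕-comm x 1#) (¬0-absorb x)

  -- In the Łukasiewicz axiom for `1#` and `x`, one side reduces to `(¬ x) ⊕ x` while the other ends
  -- in the absorbing summand `1#`.
  ¬x⊕x≈1 : ∀ x → ((¬ x) ⊕ x) ≈ 1#
  ¬x⊕x≈1 x = begin
    (¬ x) ⊕ x                     ≈⟨ ⊕-congʳ (¬-cong (⊕-identityˡ x)) ⟨
    (¬ (0# ⊕ x)) ⊕ x              ≈⟨ ⊕-congʳ (¬-cong (⊕-congʳ (¬¬-involutive 0#))) ⟨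
    (¬ ((¬ 1#) ⊕ x)) ⊕ x          ≈⟨ łukasiewicz 1# x ⟩
    (¬ ((¬ x) ⊕ 1#)) ⊕ 1#         ≈⟨ x⊕1≈1 _ ⟩
    1#                            ∎

  x∸x≈0 : ∀ x → (x ∸ x) ≈ 0#
  x∸x≈0 x = trans (¬-cong (¬x⊕x≈1 x)) (¬¬-involutive 0#)

  x∸1≈0 : ∀ x → (x ∸ 1#) ≈ 0#
  x∸1≈0 x = trans (¬-cong (x⊕1≈1 (¬ x))) (¬¬-involutive 0#)

  x∸0≈x : ∀ x → (x ∸ 0#) ≈ x
  x∸0≈x x = trans (¬-cong (⊕-identityʳ (¬ x))) (¬¬-involutive x)

  0∸x≈0 : ∀ x → (0# ∸ x) ≈ 0#
  0∸x≈0 x = trans (¬-cong (¬0-absorb x)) (¬¬-involutive 0#)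

  1∸x≈¬x : ∀ x → (1# ∸ x) ≈ (¬ x)
  1∸x≈¬x x = ¬-cong (trans (⊕-congʳ (¬¬-involutive 0#)) (⊕-identityˡ x))

  ∸-∸ : ∀ x y z → ((x ∸ y) ∸ z) ≈ (x ∸ (y ⊕ z))
  ∸-∸ x y z = ¬-cong (trans (⊕-congʳ (¬¬-involutive _)) (⊕-assoc (¬ x) y z))

  x⊕[y∸x]-comm : ∀ x y → (x ⊕ (y ∸ x)) ≈ (y ⊕ (x ∸ y))
  x⊕[y∸x]-comm x y = trans (⊕-comm x (y ∸ x)) (trans (łukasiewicz y x) (⊕-comm (x ∸ y) y))

  isDifferenceAlgebra : IsDifferenceAlgebra _≈_ _∸_ 0#
  isDifferenceAlgebra = record
    { isEquivalence = isEquivalence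
    ; ∸-cong = ∸-cong
    ; x∸0≈x = x∸0≈x
    ; 0∸x≈0 = 0∸x≈0
    ; x∸x≈0 = x∸x≈0
    ; exchange = λ x y z → trans (∸-∸ x y z) (trans (∸-cong refl (⊕-comm y z)) (sym (∸-∸ x z y)))
    -- Since `x ∸ y` equals `(¬ y) ∸ (¬ x)`, this is, below the outer negation, the commutativity of
    -- the join of `¬ x` and `¬ y`.
    ; meet-comm = λ x y → ¬-cong (begin
        (¬ x) ⊕ (¬ ((¬ x) ⊕ y))                ≈⟨ ⊕-congˡ (¬-cong (flip x y)) ⟩
        (¬ x) ⊕ ((¬ y) ∸ (¬ x))                ≈⟨ x⊕[y∸x]-comm (¬ x) (¬ y) ⟩
        (¬ y) ⊕ ((¬ x) ∸ (¬ y))                ≈⟨ ⊕-congˡ (¬-cong (flip y x)) ⟨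
        (¬ y) ⊕ (¬ ((¬ y) ⊕ x))                ∎)
    ; cube = λ x y z → begin
        (x ∸ y) ∸ (z ∸ y)     ≈⟨ ∸-∸ x y (z ∸ y) ⟩
        x ∸ (y ⊕ (z ∸ y))     ≈⟨ ∸-cong refl (x⊕[y∸x]-comm y z) ⟩
        x ∸ (z ⊕ (y ∸ z))     ≈⟨ ∸-∸ x z (y ∸ z) ⟨
        (x ∸ z) ∸ (y ∸ z)     ∎
    }
    where
    flip : ∀ x y → ((¬ x) ⊕ y) ≈ ((¬ (¬ y)) ⊕ (¬ x))
    flip x y = trans (⊕-comm (¬ x) y) (⊕-congʳ (sym (¬¬-involutive y)))

  open WordCone isDifferenceAlgebra public using (_⊘_; _⊝_; cone)
  open Cone cone public using (_≤_; ≤-refl; ≤-trans; +-monoʳ-≤; y+[x∸y]≤x; ≤+⇒∸≤)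
    renaming (_≈_ to _~_)
  open Differences cone public hiding (_∨_)
  open ConeProperties cone public
  open IsCommutativeMonoid (Cone.+-isCommutativeMonoid cone) public using ()
    renaming (comm to ++-comm; identityʳ to ~-identityʳ; ∙-cong to ++-cong;
              sym to ~-sym; trans to ~-trans; refl to ~-refl)

  letters-≤ : ∀ {x y} → (x ∸ y) ≈ 0# → [ x ] ≤ [ y ]
  letters-≤ p = p ∷ []

  letters-~⇒≈ : ∀ {x y} → [ x ] ~ [ y ] → x ≈ y
  letters-~⇒≈ {x} {y} (p ∷ [] , q ∷ []) = begin
    x             ≈⟨ x∸0≈x x ⟨
    x ∸ 0#        ≈⟨ ∸-cong refl p ⟨
    x ∸ (x ∸ y)   ≈⟨ IsDifferenceAlgebra.meet-comm isDifferenceAlgebra x y ⟩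
    y ∸ (y ∸ x)   ≈⟨ ∸-cong refl q ⟩
    y ∸ 0#        ≈⟨ x∸0≈x y ⟩
    y             ∎

  letters-≈⇒~ : ∀ {x y} → x ≈ y → [ x ] ~ [ y ]
  letters-≈⇒~ {x} {y} p =
    letters-≤ (trans (∸-cong p refl) (x∸x≈0 y)) , letters-≤ (trans (∸-cong refl p) (x∸x≈0 y))

  word-bound : ∀ u → Σ ℕ λ n → u ≤ times _++_ [] n [ 1# ]
  word-bound []      = 0 , []
  word-bound (x ∷ u) with word-bound u
  ... | n , u≤t = suc n ,
    ≤-trans {x ∷ u} {1# ∷ u} (+-monoˡ-≤ u {[ x ]} {[ 1# ]} (letters-≤ (x∸1≈0 x)))
      (+-monoʳ-≤ [ 1# ] {u} u≤t)

  module J = JoinOrderedGroupProperties joinOrderedGroup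
  -- The argument `[]` proves `0 ≤ 1`: the empty word minus any word is empty.
  module U = J.Unital (ι [ 1# ]) [] (unitBound [ 1# ] word-bound)

  G : ULM (c ⊔ ℓ) (c ⊔ ℓ)
  G = U.ulm

  module Γ = RawMVM (Γ G)

  open Differences cone using () renaming (_∨_ to _∨̇_)

  from : Carrier → Γ.Carrier
  from x = ι [ x ] , J.≤⇒meet {[] − []} {ι [ x ]} [] ,
    J.≤⇒meet {ι [ x ]} {ι [ 1# ]} (letters-≤ (x∸1≈0 x))

  truncate : List Carrier → Carrier
  truncate w = 1# ∸ (1# ⊘ w)

  to : Γ.Carrier → Carrier
  to ((u − v) , _) = truncate (u ⊝ v)

  -- Subtraction keeps the length of the minuend, so the meet `[ 1# ] ⊝ ([ 1# ] ⊝ w)` in the cone is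
  -- the one-letter word `[ truncate w ]`.
  truncate-~ : ∀ w → w ≤ [ 1# ] → [ truncate w ] ~ w
  truncate-~ w w≤1 = x∸[x∸y]≤y [ 1# ] w , x∸[x∸y]-greatest {[ 1# ]} {w} {w} w≤1 (≤-refl w)

  -- As `v ≤ u`, the difference `u − v` equals the word `u ⊝ v`; as `u ≤ v ++ [ 1# ]`, this word
  -- lies below the unit and is equivalent to its truncation.
  from∘to : ∀ x → from (to x) Γ.≈ x
  from∘to ((u − v) , 0≤x , x≤1) = eq
    where
    v≤u : v ≤ u
    v≤u = ≤-trans {v} {u ++ []} {u} (J.meet⇒≤ {[] − []} {u − v} 0≤x) (proj₁ (~-identityʳ u))
    u≤v+1 : u ≤ v ++ [ 1# ]
    u≤v+1 = ≤-trans {u} {u ++ []} {v ++ [ 1# ]} (proj₂ (~-identityʳ u))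
      (≤-trans {u ++ []} {1# ∷ v} {v ++ [ 1# ]} (J.meet⇒≤ {u − v} {ι [ 1# ]} x≤1)
        (proj₁ (++-comm [ 1# ] v)))
    w = u ⊝ v
    eq : [ truncate w ] ++ v ~ u ++ []
    eq = ~-trans {[ truncate w ] ++ v} {w ++ v} {u ++ []}
           (++-cong {[ truncate w ]} {w} {v} {v} (truncate-~ w (≤+⇒∸≤ u v [ 1# ] u≤v+1)) (~-refl {v}))
         (~-trans {w ++ v} {v ++ w} {u ++ []} (++-comm w v)
         (~-trans {v ++ w} {u} {u ++ []} (y+[x∸y]≤x u v v≤u , x≤y+[x∸y] u v)
           (~-sym {u ++ []} {u} (~-identityʳ u))))

  ι-reflects-~ : ∀ {u v} → ι u ≃ ι v → u ~ v
  ι-reflects-~ {u} {v} p = ~-trans {u} {u ++ []} {v} (~-sym {u ++ []} {u} (~-identityʳ u))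
    (~-trans {u ++ []} {v ++ []} {v} p (~-identityʳ v))

  from-injective : ∀ {x y} → from x Γ.≈ from y → x ≈ y
  from-injective {x} {y} p = letters-~⇒≈ (ι-reflects-~ {[ x ]} {[ y ]} p)

  from-cong : ∀ {x y} → x ≈ y → from x Γ.≈ from y
  from-cong p = letters-≈⇒~ p

  -- Every element of the unit interval is represented by a letter, so a
  -- universal property only has to be tested on letters.
  from-lub : ∀ z p q (r : Γ.Carrier) → proj₁ r ≡ (p ∨̇ q) →
             p ⊑ ι [ z ] → q ⊑ ι [ z ] →
             (∀ t → p ⊑ ι [ t ] → q ⊑ ι [ t ] → [ z ] ≤ [ t ]) → from z Γ.≈ r
  from-lub z p q r ≡.refl p≤z q≤z least =
      ⊑-trans {ι [ z ]} {ι [ t ]} {p ∨̇ q}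
        (least t (⊑-trans {p} {p ∨̇ q} {ι [ t ]} (J.x≤x∨y p q) (proj₂ t≃r))
                 (⊑-trans {q} {p ∨̇ q} {ι [ t ]} (J.y≤x∨y p q) (proj₂ t≃r)))
        (proj₁ t≃r)
    , J.∨-least {p} {q} {ι [ z ]} p≤z q≤z
    where
    t = to r
    t≃r : ι [ t ] ≃ (p ∨̇ q)
    t≃r = from∘to r

  from-glb : ∀ z p q (r : Γ.Carrier) → proj₁ r ≡ (p J.∧ q) →
             ι [ z ] ⊑ p → ι [ z ] ⊑ q →
             (∀ t → ι [ t ] ⊑ p → ι [ t ] ⊑ q → [ t ] ≤ [ z ]) → from z Γ.≈ r
  from-glb z p q r ≡.refl z≤p z≤q greatest =
      J.∧-greatest {p} {q} {ι [ z ]} z≤p z≤q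
    , ⊑-trans {p J.∧ q} {ι [ t ]} {ι [ z ]}
        (proj₂ t≃r)
        (greatest t (⊑-trans {ι [ t ]} {p J.∧ q} {p} (proj₁ t≃r) (J.x∧y≤x p q))
                    (⊑-trans {ι [ t ]} {p J.∧ q} {q} (proj₁ t≃r) (J.x∧y≤y p q)))
    where
    t = to r
    t≃r : ι [ t ] ≃ (p J.∧ q)
    t≃r = from∘to r

  x⊕y∸x∸y≈0 : ∀ x y → (((x ⊕ y) ∸ x) ∸ y) ≈ 0#
  x⊕y∸x∸y≈0 x y = trans (∸-∸ (x ⊕ y) x y) (x∸x≈0 (x ⊕ y))

  -- By `∸-∸`, subtracting the word `x ∷ y ∷ []` from a letter amounts to subtracting `x ⊕ y`, so
  -- `x ⊕ y` is the largest letter below that word.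
  from-⊕ : ∀ x y → from (x ⊕ y) Γ.≈ (from x Γ.⊕ from y)
  from-⊕ x y = from-glb (x ⊕ y) (ι [ x ] ⊞ ι [ y ]) (ι [ 1# ]) (from x Γ.⊕ from y) ≡.refl
    (x⊕y∸x∸y≈0 x y ∷ [])
    (letters-≤ (x∸1≈0 (x ⊕ y)))
    (λ { t (t∸x∸y≈0 ∷ []) _ → letters-≤ (trans (sym (∸-∸ t x y)) t∸x∸y≈0) })

  -- When `1# ∷ t ∷ []` is subtracted from `x ∷ y ∷ []`, the letter `x` disappears against `1#`, of
  -- which `1# ∸ x` is left. Since `y ∸ (1# ∸ x)` is `x ⊙ y`, the inequality of words says that
  -- `x ⊙ y` is below `t`.
  from-⊙ : ∀ x y → from (x ⊙ y) Γ.≈ (from x Γ.⊙ from y)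
  from-⊙ x y = from-lub (x ⊙ y) ((ι [ x ] ⊞ ι [ y ]) ⊞ (⊟ ι [ 1# ])) ([] − []) (from x Γ.⊙ from y) ≡.refl
    (≤-trans {x ∷ y ∷ []} {1# ∷ x ⊙ y ∷ []} {x ⊙ y ∷ 1# ∷ []}
      (trans (∸-cong (x∸1≈0 x) refl) (0∸x≈0 (x ⊙ y)) ∷
       trans (trans (∸-cong y∸¬x≈x⊙y refl) (∸-cong refl (trans (∸-cong refl (x∸1≈0 x)) (x∸0≈x (x ⊙ y)))))
             (x∸x≈0 (x ⊙ y)) ∷ [])
      (proj₁ (++-comm [ 1# ] [ x ⊙ y ])))
    []
    (λ t p _ → bound t (≤-trans {x ∷ y ∷ []} {t ∷ 1# ∷ []} {1# ∷ t ∷ []} p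
      (proj₁ (++-comm [ t ] [ 1# ]))))
    where
    y∸¬x≈x⊙y : (y ∸ (1# ∸ x)) ≈ (x ⊙ y)
    y∸¬x≈x⊙y = ¬-cong (trans (⊕-congˡ (1∸x≈¬x x)) (⊕-comm (¬ y) (¬ x)))
    bound : ∀ t → x ∷ y ∷ [] ≤ 1# ∷ t ∷ [] → [ x ⊙ y ] ≤ [ t ]
    bound t (_ ∷ p ∷ []) = letters-≤ (trans
      (∸-cong (sym y∸¬x≈x⊙y) (sym (trans (∸-cong refl (x∸1≈0 x)) (x∸0≈x t)))) p)

  from-∨ : ∀ x y → from (x ∨ y) Γ.≈ (from x Γ.∨ from y)
  from-∨ x y = from-lub (x ∨ y) (ι [ x ]) (ι [ y ]) (from x Γ.∨ from y) ≡.refl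
    (letters-≤ (begin
      x ∸ (x ∨ y)                     ≈⟨ ∸-cong refl (⊕-comm _ y) ⟩
      x ∸ (y ⊕ (x ⊙ (¬ y)))           ≈⟨ ∸-∸ x y _ ⟨
      (x ∸ y) ∸ (x ⊙ (¬ y))           ≈⟨ ∸-cong refl x⊙¬y≈x∸y ⟩
      (x ∸ y) ∸ (x ∸ y)               ≈⟨ x∸x≈0 _ ⟩
      0#                              ∎))
    (letters-≤ (begin
      y ∸ (x ∨ y)                     ≈⟨ ∸-cong refl (⊕-comm _ y) ⟩
      y ∸ (y ⊕ (x ⊙ (¬ y)))           ≈⟨ ∸-∸ y y _ ⟨
      (y ∸ y) ∸ (x ⊙ (¬ y))           ≈⟨ ∸-cong (x∸x≈0 y) refl ⟩
      0# ∸ (x ⊙ (¬ y))                ≈⟨ 0∸x≈0 _ ⟩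
      0#                              ∎))
    -- The word `y ∷ x ∸ y ∷ []` is the join of the two letters in the cone, and the letter `x ∨ y`
    -- lies below it.
    (λ t x≤t y≤t → ≤-trans {[ x ∨ y ]} {y ∷ x ∸ y ∷ []} {[ t ]}
      (trans (∸-cong refl (sym x⊙¬y≈x∸y)) (trans
        (∸-cong (∸-cong (⊕-comm _ y) refl) refl) (x⊕y∸x∸y≈0 y _)) ∷ [])
      (⋎-least {[ x ]} {[ y ]} {[ t ]} x≤t y≤t))
    where
    x⊙¬y≈x∸y : (x ⊙ (¬ y)) ≈ (x ∸ y)
    x⊙¬y≈x∸y = ¬-cong (⊕-congˡ (¬¬-involutive y))

  -- `x ∧ y` unfolds to `x ∸ (x ∸ y)`, so its bounds are those of the meet in the cone.
  from-∧ : ∀ x y → from (x ∧ y) Γ.≈ (from x Γ.∧ from y)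
  from-∧ x y = from-glb (x ∧ y) (ι [ x ]) (ι [ y ]) (from x Γ.∧ from y) ≡.refl
    (x∸[x∸y]≤x [ x ] [ y ])
    (x∸[x∸y]≤y [ x ] [ y ])
    (λ t t≤x t≤y → x∸[x∸y]-greatest {[ x ]} {[ y ]} {[ t ]} t≤x t≤y)

  from-0 : from 0# Γ.≈ Γ.0#
  from-0 = refl ∷ [] , []

  from-hom : MVM-homomorphism (mvReduct B) (Γ G)
  from-hom = record
    { ⟦_⟧ = from ; cong = from-cong ; hom-⊕ = from-⊕ ; hom-⊙ = from-⊙ ; hom-∨ = from-∨ ; hom-∧ = from-∧
    ; hom-0 = from-0 ; hom-1 = ≃.refl {ι [ 1# ]} }

  isomorphism : MVM-isomorphism (Γ G) (mvReduct B)
  isomorphism = bijective⇒isomorphism G (mvReduct B) from-hom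
    (λ {x} {y} → from-injective {x} {y}) to from∘to

-- Unital ℓ-groups and their unit intervals

module UnitalLGroup {c ℓ} (M : ULM c ℓ) (reduct : IsULGReduct M) where
  open ULM M public
  open ULMLemmas M public
  open SetoidReasoning setoid

  -_ : Op₁ Carrier
  -_ = proj₁ reduct

  abelianGroup : AbelianGroup c ℓ
  abelianGroup = record { isAbelianGroup = IsUnitalLGroup.+-isAbelianGroup (proj₁ (proj₂ reduct)) }

  open AbelianGroup abelianGroup public using ()
    renaming (inverseˡ to -‿inverseˡ; inverseʳ to -‿inverseʳ; ⁻¹-cong to -‿cong;
              ∙-congˡ to +-congˡ; ∙-congʳ to +-congʳ)
  open AbelianGroupProperties abelianGroup public using ()
    renaming (∙-cancelʳ to +-cancelʳ; //-rightDividesˡ to [x-y]+y≈x; //-rightDividesʳ to [x+y]-y≈x)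
  open CommutativeSemigroupProperties (AbelianGroup.commutativeSemigroup abelianGroup) public
    using (interchange; xy∙z≈xz∙y)
  open CommutativeMonoidSolver (AbelianGroup.commutativeMonoid abelianGroup)
    using (solve; _⊜_; _⊕_)

  ≤-reflexive : ∀ {x y} → x ≈ y → x ≤ y
  ≤-reflexive p = ≤-resp refl p ≤-refl

  ≤-antisym : ∀ {x y} → x ≤ y → y ≤ x → x ≈ y
  ≤-antisym {x} {y} p q = trans (sym p) (trans (∧-comm x y) q)

  x≤y⇒x∨y≈y : ∀ {x y} → x ≤ y → (x ∨ y) ≈ y
  x≤y⇒x∨y≈y p = ≤-antisym (∨-lub p ≤-refl) (y≤x∨y _ _)

  x+z≈y⇒y-z≈x : ∀ {x y z} → (x + z) ≈ y → (y + (- z)) ≈ x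
  x+z≈y⇒y-z≈x {x} {y} {z} p = trans (+-congʳ (sym p)) ([x+y]-y≈x z x)

  x+z≤y+z⇒x≤y : ∀ {x y} z → (x + z) ≤ (y + z) → x ≤ y
  x+z≤y+z⇒x≤y {x} {y} z p = ≤-resp ([x+y]-y≈x z x) ([x+y]-y≈x z y) (+-monoˡ-≤ (- z) p)

  x≤x+y : ∀ {x y} → 0# ≤ y → x ≤ (x + y)
  x≤x+y {x} {y} 0≤y = ≤-resp (+-identityʳ x) refl (+-monoʳ-≤ x 0≤y)

  -- For `≤`, distribute over the join and bound the meet in each term by the other variable; the
  -- converse is dual.
  ∧+∨ : ∀ x y → ((x ∧ y) + (x ∨ y)) ≈ (x + y)
  ∧+∨ x y = ≤-antisym
    (≤-resp (sym (proj₁ +-distrib-∨ (x ∧ y) x y)) refl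
      (∨-lub (≤-resp refl (+-comm y x) (+-monoˡ-≤ x (x∧y≤y x y))) (+-monoˡ-≤ y (x∧y≤x x y))))
    (≤-resp refl (sym (proj₂ +-distrib-∧ (x ∨ y) x y))
      (∧-glb (+-monoʳ-≤ x (y≤x∨y x y)) (≤-resp (+-comm y x) refl (+-monoʳ-≤ y (x≤x∨y x y)))))

  _∸_ : Op₂ Carrier
  x ∸ y = (x + (- y)) ∨ 0#

  ∸-cong : ∀ {x x′ y y′} → x ≈ x′ → y ≈ y′ → (x ∸ y) ≈ (x′ ∸ y′)
  ∸-cong p q = ∨-cong (+-cong p (-‿cong q)) refl

  0≤x∸y : ∀ x y → 0# ≤ (x ∸ y)
  0≤x∸y x y = y≤x∨y _ _

  -- This reduces identities about `_∸_` to identities about joins: add the subtrahend to both sides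
  -- and cancel it at the end.
  [x∸y]+y : ∀ x y → ((x ∸ y) + y) ≈ (x ∨ y)
  [x∸y]+y x y = trans (proj₂ +-distrib-∨ y _ _) (∨-cong ([x-y]+y≈x y x) (+-identityˡ y))

  [x∧y]+[x∸y] : ∀ x y → ((x ∧ y) + (x ∸ y)) ≈ x
  [x∧y]+[x∸y] x y = +-cancelʳ y _ _ (begin
    ((x ∧ y) + (x ∸ y)) + y ≈⟨ +-assoc _ _ _ ⟩
    (x ∧ y) + ((x ∸ y) + y) ≈⟨ +-congˡ ([x∸y]+y x y) ⟩
    (x ∧ y) + (x ∨ y)       ≈⟨ ∧+∨ x y ⟩
    x + y                   ∎)

  x≤y⇒x∸y≈0 : ∀ {x y} → x ≤ y → (x ∸ y) ≈ 0#
  x≤y⇒x∸y≈0 {x} {y} p = x≤y⇒x∨y≈y (≤-resp refl (-‿inverseʳ y) (+-monoˡ-≤ (- y) p))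

  x∸y≈0⇒x≤y : ∀ {x y} → (x ∸ y) ≈ 0# → x ≤ y
  x∸y≈0⇒x≤y {x} {y} p =
    ≤-resp refl (trans (sym ([x∸y]+y x y)) (trans (+-congʳ p) (+-identityˡ y))) (x≤x∨y x y)

  ∸-∸ : ∀ x y {z} → 0# ≤ z → ((x ∸ y) ∸ z) ≈ (x ∸ (y + z))
  ∸-∸ x y {z} 0≤z = +-cancelʳ (y + z) _ _ (begin
    ((x ∸ y) ∸ z) + (y + z)   ≈⟨ solve 3 (λ w y z → w ⊕ (y ⊕ z) ⊜ (w ⊕ z) ⊕ y) refl _ y z ⟩
    (((x ∸ y) ∸ z) + z) + y   ≈⟨ +-congʳ ([x∸y]+y (x ∸ y) z) ⟩
    ((x ∸ y) ∨ z) + y         ≈⟨ proj₂ +-distrib-∨ y _ _ ⟩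
    ((x ∸ y) + y) ∨ (z + y)   ≈⟨ ∨-cong ([x∸y]+y x y) (+-comm z y) ⟩
    (x ∨ y) ∨ (y + z)         ≈⟨ ∨-assoc x y _ ⟩
    x ∨ (y ∨ (y + z))         ≈⟨ ∨-cong refl (x≤y⇒x∨y≈y (x≤x+y 0≤z)) ⟩
    x ∨ (y + z)               ≈⟨ [x∸y]+y x (y + z) ⟨
    (x ∸ (y + z)) + (y + z)   ∎)

  -- After adding `y`, the left side becomes `(x + z) ∨ (x ∨ y)`, where `x + z` absorbs `x` because
  -- `z` is nonnegative.
  +-∸ : ∀ x y {z} → 0# ≤ z → ((x ∸ y) + (z ∸ (y ∸ x))) ≈ ((x + z) ∸ y)
  +-∸ x y {z} 0≤z = +-cancelʳ y _ _ (begin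
    ((x ∸ y) + w) + y             ≈⟨ xy∙z≈xz∙y (x ∸ y) w y ⟩
    ((x ∸ y) + y) + w             ≈⟨ +-congʳ ([x∸y]+y x y) ⟩
    (x ∨ y) + w                   ≈⟨ +-congʳ (trans (∨-comm x y) (sym ([x∸y]+y y x))) ⟩
    ((y ∸ x) + x) + w             ≈⟨ solve 3 (λ a w x → (a ⊕ x) ⊕ w ⊜ (w ⊕ a) ⊕ x) refl (y ∸ x) w x ⟩
    (w + (y ∸ x)) + x             ≈⟨ +-congʳ ([x∸y]+y z (y ∸ x)) ⟩
    (z ∨ (y ∸ x)) + x             ≈⟨ proj₂ +-distrib-∨ x _ _ ⟩
    (z + x) ∨ ((y ∸ x) + x)       ≈⟨ ∨-cong (+-comm z x) (trans ([x∸y]+y y x) (∨-comm y x)) ⟩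
    (x + z) ∨ (x ∨ y)             ≈⟨ ∨-assoc _ x y ⟨
    ((x + z) ∨ x) ∨ y             ≈⟨ ∨-cong (trans (∨-comm _ x) (x≤y⇒x∨y≈y (x≤x+y 0≤z))) refl ⟩
    (x + z) ∨ y                   ≈⟨ [x∸y]+y (x + z) y ⟨
    ((x + z) ∸ y) + y             ∎)
    where w = z ∸ (y ∸ x)

  module A = RawMVM (Γ M)

  ¬_ : Op₁ A.Carrier
  ¬ (x , 0≤x , x≤1) = (1# + (- x)) ,
    ≤-resp (-‿inverseʳ x) refl (+-monoˡ-≤ (- x) x≤1) ,
    ≤-resp refl ([x-y]+y≈x x 1#) (x≤x+y 0≤x)

  ¬-cong : ∀ x y → x A.≈ y → (¬ x) A.≈ (¬ y)
  ¬-cong _ _ p = +-congˡ (-‿cong p)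

  ¬¬-involutive : ∀ x → (¬ (¬ x)) A.≈ x
  ¬¬-involutive (x , _) = x+z≈y⇒y-z≈x (trans (+-comm x _) ([x-y]+y≈x x 1#))

  -- Negating a truncated sum: 1 − (z ∧ 1) = (1 − z) ∨ 0.
  1-[z∧1] : ∀ {w z} → (w + z) ≈ 1# → (1# + (- (z ∧ 1#))) ≈ (w ∨ 0#)
  1-[z∧1] {w} {z} w+z≈1 = x+z≈y⇒y-z≈x (+-cancelʳ z _ _ (begin
    ((w ∨ 0#) + (z ∧ 1#)) + z   ≈⟨ +-congʳ (+-comm _ _) ⟩
    ((z ∧ 1#) + (w ∨ 0#)) + z   ≈⟨ +-assoc _ _ _ ⟩
    (z ∧ 1#) + ((w ∨ 0#) + z)   ≈⟨ +-congˡ (proj₂ +-distrib-∨ z w 0#) ⟩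
    (z ∧ 1#) + ((w + z) ∨ (0# + z)) ≈⟨ +-congˡ (∨-cong w+z≈1 (+-identityˡ z)) ⟩
    (z ∧ 1#) + (1# ∨ z)         ≈⟨ +-congˡ (∨-comm 1# z) ⟩
    (z ∧ 1#) + (z ∨ 1#)         ≈⟨ ∧+∨ z 1# ⟩
    z + 1#                      ≈⟨ +-comm z 1# ⟩
    1# + z                      ∎))

  ¬[¬x⊕y]≈x∸y : ∀ x y → proj₁ (¬ ((¬ x) A.⊕ y)) ≈ (proj₁ x ∸ proj₁ y)
  ¬[¬x⊕y]≈x∸y (x , _) (y , _) = 1-[z∧1] (begin
    (x + (- y)) + ((1# + (- x)) + y)
      ≈⟨ solve 5 (λ x x′ y y′ e → (x ⊕ y′) ⊕ ((e ⊕ x′) ⊕ y) ⊜ (x ⊕ x′) ⊕ ((y ⊕ y′) ⊕ e))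
               refl x (- x) y (- y) 1# ⟩
    (x + (- x)) + ((y + (- y)) + 1#)
      ≈⟨ +-cong (-‿inverseʳ x) (+-congʳ (-‿inverseʳ y)) ⟩
    0# + (0# + 1#)
      ≈⟨ trans (+-identityˡ _) (+-identityˡ 1#) ⟩
    1# ∎)

  open UnitInterval M using (⊕-cong; ⊙-cong) public

  ¬[¬x⊕y]⊕y≈x∨y : ∀ x y → ((¬ ((¬ x) A.⊕ y)) A.⊕ y) A.≈ (x A.∨ y)
  ¬[¬x⊕y]⊕y≈x∨y x@(_ , _ , x≤1) y@(_ , _ , y≤1) =
    trans (∧-congʳ (trans (+-congʳ (¬[¬x⊕y]≈x∸y x y)) ([x∸y]+y _ _))) (∨-lub x≤1 y≤1)

  x⊙y≈¬[¬x⊕¬y] : ∀ x y → (x A.⊙ y) A.≈ (¬ ((¬ x) A.⊕ (¬ y)))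
  x⊙y≈¬[¬x⊕¬y] (x , _) (y , _) = sym (1-[z∧1] (begin
    ((x + y) + -1#) + ((1# + (- x)) + (1# + (- y)))
      ≈⟨ solve 6 (λ x x′ y y′ e e′ → ((x ⊕ y) ⊕ e′) ⊕ ((e ⊕ x′) ⊕ (e ⊕ y′))
                                       ⊜ (x ⊕ x′) ⊕ ((y ⊕ y′) ⊕ ((e′ ⊕ e) ⊕ e)))
               refl x (- x) y (- y) 1# -1# ⟩
    (x + (- x)) + ((y + (- y)) + ((-1# + 1#) + 1#))
      ≈⟨ +-cong (-‿inverseʳ x) (+-cong (-‿inverseʳ y) (+-congʳ -1+1≈0)) ⟩
    0# + (0# + (0# + 1#))
      ≈⟨ trans (+-identityˡ _) (trans (+-identityˡ _) (+-identityˡ 1#)) ⟩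
    1# ∎))

  x⊙¬y≈x∸y : ∀ x y → proj₁ (x A.⊙ (¬ y)) ≈ (proj₁ x ∸ proj₁ y)
  x⊙¬y≈x∸y (x , _) (y , _) = ∨-cong (begin
    (x + (1# + (- y))) + -1#
      ≈⟨ solve 4 (λ x y′ e e′ → (x ⊕ (e ⊕ y′)) ⊕ e′ ⊜ (e′ ⊕ e) ⊕ (x ⊕ y′)) refl x (- y) 1# -1# ⟩
    (-1# + 1#) + (x + (- y))
      ≈⟨ trans (+-congʳ -1+1≈0) (+-identityˡ _) ⟩
    x + (- y) ∎) refl

  -- The inner truncation contributes only the bound `1# + y`, which lies above the outer bound
  -- `1#`.
  [x∧1+y]∧1 : ∀ x {y} → 0# ≤ y → (((x ∧ 1#) + y) ∧ 1#) ≈ ((x + y) ∧ 1#)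
  [x∧1+y]∧1 x {y} 0≤y = begin
    ((x ∧ 1#) + y) ∧ 1#         ≈⟨ ∧-congʳ (proj₂ +-distrib-∧ y x 1#) ⟩
    ((x + y) ∧ (1# + y)) ∧ 1#   ≈⟨ ∧-assoc _ _ _ ⟩
    (x + y) ∧ ((1# + y) ∧ 1#)   ≈⟨ ∧-congˡ (trans (∧-comm _ _) (x≤x+y 0≤y)) ⟩
    (x + y) ∧ 1#                ∎

  ⊕-comm : ∀ x y → (x A.⊕ y) A.≈ (y A.⊕ x)
  ⊕-comm (x , _) (y , _) = ∧-congʳ (+-comm x y)

  ⊕-assoc : ∀ x y z → ((x A.⊕ y) A.⊕ z) A.≈ (x A.⊕ (y A.⊕ z))
  ⊕-assoc (x , 0≤x , _) (y , _) (z , 0≤z , _) = begin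
    (((x + y) ∧ 1#) + z) ∧ 1#   ≈⟨ [x∧1+y]∧1 (x + y) 0≤z ⟩
    ((x + y) + z) ∧ 1#          ≈⟨ ∧-congʳ (trans (+-assoc x y z) (+-comm x _)) ⟩
    ((y + z) + x) ∧ 1#          ≈⟨ [x∧1+y]∧1 (y + z) 0≤x ⟨
    (((y + z) ∧ 1#) + x) ∧ 1#   ≈⟨ ∧-congʳ (+-comm _ x) ⟩
    (x + ((y + z) ∧ 1#)) ∧ 1#   ∎

  ⊕-identityˡ : ∀ x → (A.0# A.⊕ x) A.≈ x
  ⊕-identityˡ (x , _ , x≤1) = trans (∧-congʳ (+-identityˡ x)) x≤1

  1≈¬0 : A.1# A.≈ (¬ A.0#)
  1≈¬0 = sym (x+z≈y⇒y-z≈x (+-identityʳ 1#))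

  isMVAlgebra : IsMVAlgebra A._≈_ A._⊕_ ¬_ A.0#
  isMVAlgebra = record
    { ⊕-isCommutativeMonoid = record
      { isMonoid = record
        { isSemigroup = record
          { isMagma = record
            { isEquivalence = record { refl = refl ; sym = sym ; trans = trans }
            ; ∙-cong = λ {x} {y} {u} {v} → ⊕-cong x y u v
            }
          ; assoc = ⊕-assoc
          }
        ; identity = ⊕-identityˡ , λ x → trans (⊕-comm x A.0#) (⊕-identityˡ x)
        }
      ; comm = ⊕-comm
      }
    ; ¬-cong = λ {x} {y} → ¬-cong x y
    ; ¬0-absorb = λ x@(_ , 0≤x , _) →
        trans (∧-comm _ _) (trans (≤-trans (≤-reflexive 1≈¬0) (x≤x+y 0≤x)) 1≈¬0)
    ; ¬¬-involutive = ¬¬-involutive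
    ; łukasiewicz = λ x y → trans (¬[¬x⊕y]⊕y≈x∨y x y)
        (trans (∨-comm _ _) (sym (¬[¬x⊕y]⊕y≈x∨y y x)))
    }

  isMVReduct : IsMVReduct (Γ M)
  isMVReduct = ¬_ , isMVAlgebra , x⊙y≈¬[¬x⊕¬y] , ∨-derived , ∧-derived , 1≈¬0
    where
    open MVDerived A._⊕_ ¬_ A.0# renaming (_⊙_ to _⊙′_; _∨_ to _∨′_; _∧_ to _∧′_)
    ∨-derived : ∀ x y → (x A.∨ y) A.≈ (x ∨′ y)
    ∨-derived x y = sym (trans (⊕-cong (x ⊙′ (¬ y)) (¬ ((¬ x) A.⊕ y)) y y
        (¬-cong ((¬ x) A.⊕ (¬ (¬ y))) ((¬ x) A.⊕ y)
                (⊕-cong (¬ x) (¬ x) (¬ (¬ y)) y refl (¬¬-involutive y))) refl)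
      (¬[¬x⊕y]⊕y≈x∨y x y))
    ∧-derived : ∀ x y → (x A.∧ y) A.≈ (x ∧′ y)
    ∧-derived x@(a , _) y@(b , _) = sym (begin
      proj₁ (x ∧′ y)                 ≈⟨ ¬[¬x⊕y]≈x∸y x (¬ ((¬ x) A.⊕ y)) ⟩
      a ∸ proj₁ (¬ ((¬ x) A.⊕ y))    ≈⟨ ∸-cong refl (¬[¬x⊕y]≈x∸y x y) ⟩
      a ∸ (a ∸ b)                    ≈⟨ ∨-cong (x+z≈y⇒y-z≈x ([x∧y]+[x∸y] a b)) refl ⟩
      (a ∧ b) ∨ 0#                   ≈⟨ ∨-comm _ _ ⟩
      0# ∨ (a ∧ b)                   ≈⟨ x≤y⇒x∨y≈y (proj₁ (proj₂ (x A.∧ y))) ⟩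
      a ∧ b                          ∎)

-- Sums of words and decompositions into differences

module WordSum {c ℓ} (M : ULM c ℓ) (reduct : IsULGReduct M) {a} {A : Set a}
               (value : A → ULM.Carrier M) (0≤value : ∀ x → ULM._≤_ M (ULM.0# M) (value x)) where
  open UnitalLGroup M reduct
  open SetoidReasoning setoid

  -- Letters are evaluated through an abstract `value` so that words over the unit interval of one
  -- group can be summed in that group and, through a homomorphism, in another.
  Sum : List A → Carrier
  Sum []      = 0#
  Sum (x ∷ u) = value x + Sum u

  0≤Sum : ∀ u → 0# ≤ Sum u
  0≤Sum []      = ≤-refl
  0≤Sum (x ∷ u) = +-nonneg (0≤value x) (0≤Sum u)

  Sum-++ : ∀ u v → Sum (u ++ v) ≈ (Sum u + Sum v)
  Sum-++ []      v = sym (+-identityˡ (Sum v))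
  Sum-++ (x ∷ u) v = trans (+-congˡ (Sum-++ u v)) (sym (+-assoc _ _ _))

  Sum≈0⇒All≈0 : ∀ u → Sum u ≈ 0# → All (λ x → value x ≈ 0#) u
  Sum≈0⇒All≈0 []      p = []
  Sum≈0⇒All≈0 (x ∷ u) p =
    ≤-antisym (≤-resp refl p (x≤x+y (0≤Sum u))) (0≤value x) ∷
    Sum≈0⇒All≈0 u (≤-antisym (≤-resp refl (trans (+-comm _ _) p) (x≤x+y (0≤value x))) (0≤Sum u))

  All≈0⇒Sum≈0 : ∀ {u} → All (λ x → value x ≈ 0#) u → Sum u ≈ 0#
  All≈0⇒Sum≈0 []       = refl
  All≈0⇒Sum≈0 (p ∷ ps) = trans (+-cong p (All≈0⇒Sum≈0 ps)) (+-identityˡ 0#)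

  module _ (_∸̇_ : Op₂ A) (value-∸ : ∀ x y → value (x ∸̇ y) ≈ (value x ∸ value y)) where
    open Words _∸̇_

    value-⊘ : ∀ x v → value (x ⊘ v) ≈ (value x ∸ Sum v)
    value-⊘ x []      = begin
      value x                  ≈⟨ trans (∨-comm _ _) (x≤y⇒x∨y≈y (0≤value x)) ⟨
      value x ∨ 0#             ≈⟨ ∨-cong (x+z≈y⇒y-z≈x (+-identityʳ _)) refl ⟨
      value x ∸ 0#             ∎
    value-⊘ x (y ∷ v) = begin
      value ((x ∸̇ y) ⊘ v)          ≈⟨ value-⊘ (x ∸̇ y) v ⟩
      value (x ∸̇ y) ∸ Sum v        ≈⟨ ∸-cong (value-∸ x y) refl ⟩
      (value x ∸ value y) ∸ Sum v  ≈⟨ ∸-∸ (value x) (value y) (0≤Sum v) ⟩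
      value x ∸ (value y + Sum v)  ∎

    Sum-⊖ : ∀ v x → Sum (v ⊖ x) ≈ (Sum v ∸ value x)
    Sum-⊖ []      x = sym (x≤y⇒x∸y≈0 (0≤value x))
    Sum-⊖ (y ∷ v) x = begin
      value (y ∸̇ x) + Sum (v ⊖ (x ∸̇ y))
        ≈⟨ +-cong (value-∸ y x) (trans (Sum-⊖ v (x ∸̇ y)) (∸-cong refl (value-∸ x y))) ⟩
      (value y ∸ value x) + (Sum v ∸ (value x ∸ value y))
        ≈⟨ +-∸ (value y) (value x) (0≤Sum v) ⟩
      (value y + Sum v) ∸ value x ∎

    Sum-⊝ : ∀ u v → Sum (u ⊝ v) ≈ (Sum u ∸ Sum v)
    Sum-⊝ []      v = sym (x≤y⇒x∸y≈0 (0≤Sum v))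
    Sum-⊝ (x ∷ u) v = begin
      value (x ⊘ v) + Sum (u ⊝ (v ⊖ x))
        ≈⟨ +-cong (value-⊘ x v) (trans (Sum-⊝ u (v ⊖ x)) (∸-cong refl (Sum-⊖ v x))) ⟩
      (value x ∸ Sum v) + (Sum u ∸ (Sum v ∸ value x))
        ≈⟨ +-∸ (value x) (Sum v) (0≤Sum u) ⟩
      (value x + Sum u) ∸ Sum v ∎

    Sum-join : ∀ u v → Sum (u ++ (v ⊝ u)) ≈ (Sum u ∨ Sum v)
    Sum-join u v = begin
      Sum (u ++ (v ⊝ u))       ≈⟨ Sum-++ u (v ⊝ u) ⟩
      Sum u + Sum (v ⊝ u)      ≈⟨ trans (+-congˡ (Sum-⊝ v u)) (+-comm _ _) ⟩
      (Sum v ∸ Sum u) + Sum u  ≈⟨ trans ([x∸y]+y _ _) (∨-comm _ _) ⟩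
      Sum u ∨ Sum v            ∎

module UnitIntervalWords {c ℓ} (M : ULM c ℓ) (reduct : IsULGReduct M) where
  open UnitalLGroup M reduct
  open WordSum M reduct {A = A.Carrier} proj₁ (λ x → proj₁ (proj₂ x)) public
  open SetoidReasoning setoid

  0≤times : ∀ n → 0# ≤ times _+_ 0# n 1#
  0≤times zero    = ≤-refl
  0≤times (suc n) = +-nonneg 0≤1 (0≤times n)

  -- Splitting off the letter `x ∧ 1#` leaves `x ∸ 1#`, whose bound has one unit less.
  decompose : ∀ n x → 0# ≤ x → x ≤ times _+_ 0# n 1# → Σ (List A.Carrier) λ u → Sum u ≈ x
  decompose zero    x 0≤x x≤0 = [] , ≤-antisym 0≤x x≤0
  decompose (suc n) x 0≤x x≤1+n with decompose n (x ∸ 1#) (0≤x∸y x 1#) x∸1≤n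
    where
    x∸1≤n : (x ∸ 1#) ≤ times _+_ 0# n 1#
    x∸1≤n = ∨-lub (x+z≤y+z⇒x≤y 1# (≤-resp (sym ([x-y]+y≈x 1# x)) (+-comm _ _) x≤1+n)) (0≤times n)
  ... | u , Sum-u = ((x ∧ 1#) , ∧-glb 0≤x 0≤1 , x∧y≤y x 1#) ∷ u ,
        trans (+-congˡ Sum-u) ([x∧y]+[x∸y] x 1#)

  record Decomposition (x : Carrier) : Set (c ⊔ ℓ) where
    field
      pos neg   : List A.Carrier
      x+neg≈pos : (x + Sum neg) ≈ Sum pos

  -- The two words sum to the positive parts of `x` and of `- x`.
  decomposition : ∀ x → Decomposition x
  decomposition x = record { pos = proj₁ p ; neg = proj₁ n ; x+neg≈pos = begin
      x + Sum (proj₁ n)      ≈⟨ +-congˡ (proj₂ n) ⟩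
      x + ((- x) ∨ 0#)       ≈⟨ proj₁ +-distrib-∨ x (- x) 0# ⟩
      (x + (- x)) ∨ (x + 0#) ≈⟨ ∨-cong (-‿inverseʳ x) (+-identityʳ x) ⟩
      0# ∨ x                 ≈⟨ ∨-comm 0# x ⟩
      x ∨ 0#                 ≈⟨ proj₂ p ⟨
      Sum (proj₁ p)          ∎ }
    where
    positivePart : ∀ y → Σ (List A.Carrier) λ u → Sum u ≈ (y ∨ 0#)
    positivePart y with unitBound y
    ... | n , _ , y≤n = decompose n (y ∨ 0#) (y≤x∨y y 0#) (∨-lub y≤n (0≤times n))
    p = positivePart x
    n = positivePart (- x)

-- Faithfulness and fullness

module _ {c₁ ℓ₁ c₂ ℓ₂} (G : ULM c₁ ℓ₁) (H : ULM c₂ ℓ₂)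
         (reductG : IsULGReduct G) (reductH : IsULGReduct H) where
  private
    module G = UnitalLGroup G reductG
    module H = UnitalLGroup H reductH
    module W = UnitIntervalWords G reductG
    module ΓG = RawMVM (Γ G)
    module ΓH = RawMVM (Γ H)
  open SetoidReasoning H.setoid

  faithful : (f g : ULM-homomorphism G H) →
    (∀ (a : ΓG.Carrier) → ULM-homomorphism.⟦ f ⟧ (proj₁ a) H.≈ ULM-homomorphism.⟦ g ⟧ (proj₁ a)) →
    ∀ x → ULM-homomorphism.⟦ f ⟧ x H.≈ ULM-homomorphism.⟦ g ⟧ x
  faithful f g agree x = H.+-cancelʳ f.⟦ W.Sum neg ⟧ _ _ (begin
    f.⟦ x ⟧ H.+ f.⟦ W.Sum neg ⟧   ≈⟨ f.hom-+ x (W.Sum neg) ⟨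
    f.⟦ x G.+ W.Sum neg ⟧         ≈⟨ f.cong x+neg≈pos ⟩
    f.⟦ W.Sum pos ⟧               ≈⟨ agree-Sum pos ⟩
    g.⟦ W.Sum pos ⟧               ≈⟨ g.cong x+neg≈pos ⟨
    g.⟦ x G.+ W.Sum neg ⟧         ≈⟨ g.hom-+ x (W.Sum neg) ⟩
    g.⟦ x ⟧ H.+ g.⟦ W.Sum neg ⟧   ≈⟨ H.+-congˡ (agree-Sum neg) ⟨
    g.⟦ x ⟧ H.+ f.⟦ W.Sum neg ⟧   ∎)
    where
    module f = ULM-homomorphism f
    module g = ULM-homomorphism g
    open W.Decomposition (W.decomposition x)
    agree-Sum : ∀ u → f.⟦ W.Sum u ⟧ H.≈ g.⟦ W.Sum u ⟧
    agree-Sum []      = H.trans f.hom-0 (H.sym g.hom-0)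
    agree-Sum (a ∷ u) = H.trans (f.hom-+ _ _)
      (H.trans (H.+-cong (agree a) (agree-Sum u)) (H.sym (g.hom-+ _ _)))

  module Extension (h : MVM-homomorphism (Γ G) (Γ H)) where
    private
      module h = MVM-homomorphism h

    -- The negation is not part of the signature, but h preserves it because
    -- ¬ x is the only y with x ⊕ y = 1 and x ⊙ y = 0.
    h-¬ : ∀ x → h.⟦ G.¬ x ⟧ ΓH.≈ (H.¬ h.⟦ x ⟧)
    h-¬ x = H.sym (H.x+z≈y⇒y-z≈x (H.trans (H.+-comm _ _) (H.≤-antisym upper lower)))
      where
      s = proj₁ h.⟦ x ⟧ H.+ proj₁ h.⟦ G.¬ x ⟧
      x⊕¬x≈1 : (x ΓG.⊕ (G.¬ x)) ΓG.≈ ΓG.1#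
      x⊕¬x≈1 = G.trans (G.∧-congʳ (G.trans (G.+-comm _ _) (G.[x-y]+y≈x (proj₁ x) G.1#))) G.≤-refl
      lower : H.1# H.≤ s
      lower = H.trans (H.∧-comm _ _) (begin
        s H.∧ H.1#                              ≈⟨ h.hom-⊕ x (G.¬ x) ⟨
        proj₁ h.⟦ x ΓG.⊕ (G.¬ x) ⟧              ≈⟨ h.cong {x ΓG.⊕ (G.¬ x)} {ΓG.1#} x⊕¬x≈1 ⟩
        proj₁ h.⟦ ΓG.1# ⟧                       ≈⟨ h.hom-1 ⟩
        H.1#                                    ∎)
      s-1≤0 : (s H.+ H.-1#) H.≤ H.0#
      s-1≤0 = H.≤-resp H.refl (begin
        (s H.+ H.-1#) H.∨ H.0#                  ≈⟨ h.hom-⊙ x (G.¬ x) ⟨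
        proj₁ h.⟦ x ΓG.⊙ (G.¬ x) ⟧              ≈⟨ h.cong {x ΓG.⊙ (G.¬ x)} {ΓG.0#} x⊙¬x≈0 ⟩
        proj₁ h.⟦ ΓG.0# ⟧                       ≈⟨ h.hom-0 ⟩
        H.0#                                    ∎) (H.x≤x∨y _ _)
        where
        x⊙¬x≈0 : (x ΓG.⊙ (G.¬ x)) ΓG.≈ ΓG.0#
        x⊙¬x≈0 = G.trans (G.x⊙¬y≈x∸y x x) (G.x≤y⇒x∸y≈0 G.≤-refl)
      upper : s H.≤ H.1#
      upper = H.≤-resp
        (H.trans (H.+-assoc _ _ _) (H.trans (H.+-congˡ H.-1+1≈0) (H.+-identityʳ s)))
        (H.+-identityˡ H.1#)
        (H.+-monoˡ-≤ H.1# s-1≤0)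

    _∸̇_ : Op₂ ΓG.Carrier
    x ∸̇ y = x ΓG.⊙ (G.¬ y)

    h-∸̇ : ∀ x y → proj₁ h.⟦ x ∸̇ y ⟧ H.≈ (proj₁ h.⟦ x ⟧ H.∸ proj₁ h.⟦ y ⟧)
    h-∸̇ x y = H.trans (h.hom-⊙ x (G.¬ y))
      (H.trans (H.⊙-cong h.⟦ x ⟧ h.⟦ x ⟧ h.⟦ G.¬ y ⟧ (H.¬ h.⟦ y ⟧) H.refl (h-¬ y))
               (H.x⊙¬y≈x∸y h.⟦ x ⟧ h.⟦ y ⟧))

    private
      module S = WordSum H reductH (λ x → proj₁ h.⟦ x ⟧) (λ x → proj₁ (proj₂ h.⟦ x ⟧))
    open Words _∸̇_

    -- The same word `u ⊝ v` has sum `Sum u ∸ Sum v` under both valuations, so only the vanishing of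
    -- its letters has to be carried over by `h`.
    Sum-mono : ∀ u v → W.Sum u G.≤ W.Sum v → S.Sum u H.≤ S.Sum v
    Sum-mono u v p = H.x∸y≈0⇒x≤y (H.trans (H.sym (S.Sum-⊝ _∸̇_ h-∸̇ u v))
      (S.All≈0⇒Sum≈0 (transfer (W.Sum≈0⇒All≈0 (u ⊝ v)
        (G.trans (W.Sum-⊝ _∸̇_ G.x⊙¬y≈x∸y u v) (G.x≤y⇒x∸y≈0 p))))))
      where
      transfer : ∀ {w} → All (λ x → proj₁ x G.≈ G.0#) w → All (λ x → proj₁ h.⟦ x ⟧ H.≈ H.0#) w
      transfer []       = []
      transfer {x ∷ _} (q ∷ qs) = H.trans (h.cong {x} {ΓG.0#} q) h.hom-0 ∷ transfer qs

    Sum-cong : ∀ u v → W.Sum u G.≈ W.Sum v → S.Sum u H.≈ S.Sum v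
    Sum-cong u v p = H.≤-antisym (Sum-mono u v (G.≤-reflexive p))
      (Sum-mono v u (G.≤-reflexive (G.sym p)))

    open W.Decomposition

    ext : G.Carrier → H.Carrier
    ext x = S.Sum (pos (W.decomposition x)) H.+ (H.- S.Sum (neg (W.decomposition x)))

    -- Independence of the chosen decomposition: comparing it with `u` and `v` by cross-addition
    -- gives two words with equal sums in `G`, and `Sum-cong` carries the equality to `H`.
    ext-Sum : ∀ x u v → (x G.+ W.Sum v) G.≈ W.Sum u → (ext x H.+ S.Sum v) H.≈ S.Sum u
    ext-Sum x u v x+v≈u = H.+-cancelʳ (S.Sum n) _ _ (begin
      (ext x H.+ S.Sum v) H.+ S.Sum n   ≈⟨ H.xy∙z≈xz∙y (ext x) (S.Sum v) (S.Sum n) ⟩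
      (ext x H.+ S.Sum n) H.+ S.Sum v   ≈⟨ H.+-congʳ (H.[x-y]+y≈x (S.Sum n) (S.Sum p)) ⟩
      S.Sum p H.+ S.Sum v               ≈⟨ S.Sum-++ p v ⟨
      S.Sum (p ++ v)                    ≈⟨ Sum-cong (p ++ v) (u ++ n) p+v≈u+n ⟩
      S.Sum (u ++ n)                    ≈⟨ S.Sum-++ u n ⟩
      S.Sum u H.+ S.Sum n               ∎)
      where
      p = pos (W.decomposition x)
      n = neg (W.decomposition x)
      p+v≈u+n : W.Sum (p ++ v) G.≈ W.Sum (u ++ n)
      p+v≈u+n = G.trans (W.Sum-++ p v) (G.trans (G.+-congʳ (G.sym (x+neg≈pos (W.decomposition x))))
        (G.trans (G.xy∙z≈xz∙y x (W.Sum n) (W.Sum v))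
        (G.trans (G.+-congʳ x+v≈u) (G.sym (W.Sum-++ u n)))))

    -- The homomorphism laws for `+` and `∨` and the values at constants follow by exhibiting words
    -- `u` and `v` that represent the argument in `G` and the claimed value in `H`.
    ext-unique : ∀ x {y} u v → (x G.+ W.Sum v) G.≈ W.Sum u → (y H.+ S.Sum v) H.≈ S.Sum u → ext x H.≈ y
    ext-unique x u v p q = H.+-cancelʳ (S.Sum v) _ _ (H.trans (ext-Sum x u v p) (H.sym q))

    ext-cong : ∀ {x y} → x G.≈ y → ext x H.≈ ext y
    ext-cong {x} {y} x≈y = ext-unique x (pos (W.decomposition y)) (neg (W.decomposition y))
      (G.trans (G.+-congʳ x≈y) (x+neg≈pos (W.decomposition y)))
      (ext-Sum y (pos (W.decomposition y)) (neg (W.decomposition y)) (x+neg≈pos (W.decomposition y)))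

    ext-+ : ∀ x y → ext (x G.+ y) H.≈ (ext x H.+ ext y)
    ext-+ x y = ext-unique (x G.+ y) (px ++ py) (nx ++ ny)
      (G.trans (G.+-congˡ (W.Sum-++ nx ny))
        (G.trans (G.interchange x y (W.Sum nx) (W.Sum ny))
        (G.trans (G.+-cong ex ey) (G.sym (W.Sum-++ px py)))))
      (H.trans (H.+-congˡ (S.Sum-++ nx ny))
        (H.trans (H.interchange (ext x) (ext y) (S.Sum nx) (S.Sum ny))
        (H.trans (H.+-cong (ext-Sum x px nx ex) (ext-Sum y py ny ey)) (H.sym (S.Sum-++ px py)))))
      where
      open W.Decomposition (W.decomposition x) renaming (pos to px; neg to nx; x+neg≈pos to ex)
      open W.Decomposition (W.decomposition y) renaming (pos to py; neg to ny; x+neg≈pos to ey)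

    -- Over the common denominator nx + ny the join is that of two word sums.
    ext-∨ : ∀ x y → ext (x G.∨ y) H.≈ (ext x H.∨ ext y)
    ext-∨ x y = ext-unique (x G.∨ y) (u ++ (v ⊝ u)) n
      (G.trans (proj₂ G.+-distrib-∨ _ x y)
        (G.trans (G.∨-cong x+n≈u y+n≈v) (G.sym (W.Sum-join _∸̇_ G.x⊙¬y≈x∸y u v))))
      (H.trans (proj₂ H.+-distrib-∨ _ (ext x) (ext y))
        (H.trans (H.∨-cong (ext-Sum x u n x+n≈u) (ext-Sum y v n y+n≈v))
          (H.sym (S.Sum-join _∸̇_ h-∸̇ u v))))
      where
      open W.Decomposition (W.decomposition x) renaming (pos to px; neg to nx; x+neg≈pos to ex)
      open W.Decomposition (W.decomposition y) renaming (pos to py; neg to ny; x+neg≈pos to ey)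
      n = nx ++ ny
      u = px ++ ny
      v = py ++ nx
      x+n≈u : (x G.+ W.Sum n) G.≈ W.Sum u
      x+n≈u = G.trans (G.+-congˡ (W.Sum-++ nx ny)) (G.trans (G.sym (G.+-assoc _ _ _))
        (G.trans (G.+-congʳ ex) (G.sym (W.Sum-++ px ny))))
      y+n≈v : (y G.+ W.Sum n) G.≈ W.Sum v
      y+n≈v = G.trans (G.+-congˡ (G.trans (W.Sum-++ nx ny) (G.+-comm _ _)))
        (G.trans (G.sym (G.+-assoc _ _ _))
        (G.trans (G.+-congʳ ey) (G.sym (W.Sum-++ py nx))))

    -- Meet and join add up to `x + y`, so preservation of sums and joins forces that of meets.
    ext-∧ : ∀ x y → ext (x G.∧ y) H.≈ (ext x H.∧ ext y)
    ext-∧ x y = H.+-cancelʳ (ext (x G.∨ y)) _ _ (begin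
      ext (x G.∧ y) H.+ ext (x G.∨ y)           ≈⟨ ext-+ (x G.∧ y) (x G.∨ y) ⟨
      ext ((x G.∧ y) G.+ (x G.∨ y))             ≈⟨ ext-cong (G.∧+∨ x y) ⟩
      ext (x G.+ y)                             ≈⟨ ext-+ x y ⟩
      ext x H.+ ext y                           ≈⟨ H.∧+∨ (ext x) (ext y) ⟨
      (ext x H.∧ ext y) H.+ (ext x H.∨ ext y)   ≈⟨ H.+-congˡ (ext-∨ x y) ⟨
      (ext x H.∧ ext y) H.+ ext (x G.∨ y)       ∎)

    ext-extends : ∀ (a : ΓG.Carrier) → ext (proj₁ a) H.≈ proj₁ h.⟦ a ⟧
    ext-extends a = ext-unique (proj₁ a) [ a ] [] G.refl H.refl

    extension : ULM-homomorphism G H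
    extension = record
      { ⟦_⟧ = ext ; cong = ext-cong ; hom-+ = ext-+ ; hom-∨ = ext-∨ ; hom-∧ = ext-∧
      ; hom-0 = ext-unique G.0# [] [] (G.+-identityˡ G.0#) (H.+-identityˡ H.0#)
      ; hom-1 = H.trans (ext-extends ΓG.1#) h.hom-1
      -- `-1#` is represented as the empty sum minus the single letter `1#`.
      ; hom--1 = ext-unique G.-1# [] [ ΓG.1# ]
          (G.trans (G.+-congˡ (G.+-identityʳ G.1#)) G.-1+1≈0)
          (H.trans (H.+-congˡ (H.trans (H.+-identityʳ _) h.hom-1)) H.-1+1≈0)
      }

theoremA4 : ΓRestrictsToEquivalence
theoremA4 = record
  { Γ-ULG→MV = UnitalLGroup.isMVReduct
  ; Γ-faithful = λ G H rG rH → faithful G H rG rH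
  ; Γ-full = λ G H rG rH h → Extension.extension G H rG rH h , Extension.ext-extends G H rG rH h
  ; Γ-essentiallySurjective = λ B → let open MVAlgebraProperties B in G , U.isULGReduct , isomorphism
  }
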